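{- For every algebraic type $\tau$, $$\mathsf{CA}_\tau = \mathbb I\, \mathsf{RCA}_\tau=\mathbb I\, \mathsf{FCA}_\tau=\mathbb{H}\mathbb{S}\mathbb{P}(\mathsf{FiCA}_\tau)=\mathbb{H}\mathbb{S}\mathbb{P}(\mathsf{BLK}_\tau).$$ (In particular, $\mathsf{CA} = \mathbb I\, \mathsf{RCA}=\mathbb I\, \mathsf{FCA}=\mathbb{HSP}(\mathsf{FiCA})=\mathbb{HSP}(\mathsf{BLK})$.)
   Context: Here $\omega=\{1,2,\dots\}$, and $\mathbb I,\mathbb H,\mathbb S,\mathbb P$ denote closure under isomorphic images, homomorphic images, subalgebras and direct products. A clone $\tau$-algebra is an algebra $\mathbf C=(\mathbf C_\tau,q_n,\mathsf e_i)_{n\ge 0,i\ge 1}$ where $\mathbf C_\tau=(C,\sigma)_{\sigma\in\tau}$ is a $\tau$-algebra, each $\mathsf e_i$ is a constant, each $q_n$ is $(n+1)$-ary, and: $q_n(\mathsf e_i,x_1,\dots,x_n)=x_i$ ($1\le i\le n$); $q_n(\mathsf e_j,x_1,\dots,x_n)=\mathsf e_j$ ($j>n$); $q_n(x,\mathsf e_1,\dots,\mathsf e_n)=x$; $q_k(x,y_1,\dots,y_k)=q_n(x,y_1,\dots,y_k,\mathsf e_{k+1},\dots,\mathsf e_n)$ ($n>k$); $q_n(q_n(x,\mathbf y),\mathbf z)=q_n(x,q_n(y_1,\mathbf z),\dots,q_n(y_n,\mathbf z))$; and $q_n(\sigma(x_1,\dots,x_k),\mathbf y)=\sigma(q_n(x_1,\mathbf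 y),\dots,q_n(x_k,\mathbf y))$ for every $k$-ary $\sigma\in\tau$. $\mathsf{CA}_\tau$ is the class of clone $\tau$-algebras. For a $\tau$-algebra $\mathbf A$, $r\in A^\omega$ and $a_1,\dots,a_n\in A$, let $r[a_1,\dots,a_n]$ be the sequence equal to $a_i$ at $i\le n$ and to $r_i$ at $i>n$. The full functional clone $\tau$-algebra with value domain $\mathbf A$ has universe all functions $A^\omega\to A$ and operations $\mathsf e_i(s)=s_i$, $q_n(\varphi,\psi_1,\dots,\psi_n)(s)=\varphi(s[\psi_1(s),\dots,\psi_n(s)])$, $\sigma(\psi_1,\dots,\psi_k)(s)=\sigma^{\mathbf A}(\psi_1(s),\dots,\psi_k(s))$. $\mathsf{FCA}_\tau$ is the class of its subalgebras (functional clone algebras), for all $\tau$-algebras $\mathbf A$. For $r\in A^\omega$, let $A^\omega_r$ be the set of $s\in A^\omega$ differing from $r$ in only finitely many coordinates; the full point-relativized functional clone $\tau$-algebra with value domain $\mathbf A$ and thread $r$ is defined by the same formulas on the set of all functions $A^\omega_r\to A$, and $\mathsf{RCA}_\tau$ is the class of its subalgebras. In a clone algebra, an element $a$ is independent of $\mathsf e_n$ if $q_n(a,\mathsf e_1,\dots,\mathsf e_{n-1},\mathsf e_{n+1})=a$; $a$ is finite dimensional if it depends on only finitely many $\mathsf e_n$. $\mathsf{FiCA}_\tau$ is the class of clone $\tau$-algebras all of whose elements are finite dimensional. For a finitary operation $f:A^k\to A$ ($k\ge0$), its top extension $f^\top:A^\omega\to A$ is $f^\top(s)=f(s_1,\dots,s_k)$.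 A block algebra on a $\tau$-algebra $\mathbf A$ is a subalgebra of the full functional clone $\tau$-algebra with value domain $\mathbf A$ all of whose elements are top extensions of finitary operations on $A$; $\mathsf{BLK}_\tau$ is the class of all such block algebras. $\mathsf{CA},\mathsf{RCA},\mathsf{FCA},\mathsf{FiCA},\mathsf{BLK}$ denote the corresponding classes over all types. -}

module Defs where

open import Level using (Level; _⊔_; Lift) renaming (suc to lsuc)
open import Data.Nat using (ℕ; zero; suc; _+_; _≤_; _<_; _<?_; _≟_)
open import Data.Nat.Properties using (≤-trans; m≤n+m; <⇒≱)
open import Data.Fin using (Fin; toℕ; fromℕ<)
open import Data.Vec.Functional using (_++_)
open import Data.Product using (Σ; ∃; _×_; _,_; proj₁; proj₂)
open import Data.Empty using (⊥-elim)
open import Relation.Nullary using (yes; no; ¬_)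
open import Relation.Binary using (Rel; IsEquivalence)

record Signature (ℓ : Level) : Set (lsuc ℓ) where
  field
    Op : Set ℓ
    ar : Op → ℕ
open Signature public

record Algebra {ℓ : Level} (τ : Signature ℓ) : Set (lsuc ℓ) where
  field
    Carrier : Set ℓ
    _≈_ : Rel Carrier ℓ
    isEquivalence : IsEquivalence _≈_
    ⟦_⟧ : (f : Op τ) → (Fin (ar τ f) → Carrier) → Carrier
    ⟦⟧-cong : ∀ f {xs ys} → (∀ i → xs i ≈ ys i) → ⟦ f ⟧ xs ≈ ⟦ f ⟧ ys
  open IsEquivalence isEquivalence public

-- Algebras of the clone type: τ-operations + q_n (n ≥ 0) + constants e_i.
-- Indexing convention (0-based): the constant 𝖾_i (i ≥ 1) of the paper
-- is  e (i - 1);  the argument x_i (1 ≤ i ≤ n) of q_n is  xs (i - 1).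

record CloneStr {ℓ : Level} (τ : Signature ℓ) : Set (lsuc ℓ) where
  field
    alg : Algebra τ
  open Algebra alg public
  field
    q : (n : ℕ) → Carrier → (Fin n → Carrier) → Carrier
    q-cong : ∀ n {x y xs ys} → x ≈ y → (∀ i → xs i ≈ ys i) → q n x xs ≈ q n y ys
    e : ℕ → Carrier

record IsCA {ℓ : Level} {τ : Signature ℓ} (C : CloneStr τ) : Set ℓ where
  open CloneStr C
  field
    q-e-proj : ∀ n (i : Fin n) (xs : Fin n → Carrier) → q n (e (toℕ i)) xs ≈ xs i
    q-e-out : ∀ n j → n ≤ j → ∀ (xs : Fin n → Carrier) → q n (e j) xs ≈ e j
    q-unit : ∀ n x → q n x (λ i → e (toℕ i)) ≈ x
    q-pad : ∀ k m x (ys : Fin k → Carrier) →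
            q k x ys ≈ q (k + suc m) x (ys ++ (λ j → e (k + toℕ j)))
    q-assoc : ∀ n x (ys zs : Fin n → Carrier) →
              q n (q n x ys) zs ≈ q n x (λ i → q n (ys i) zs)
    q-op : ∀ f (xs : Fin (ar τ f) → Carrier) n (ys : Fin n → Carrier) →
           q n (⟦ f ⟧ xs) ys ≈ ⟦ f ⟧ (λ i → q n (xs i) ys)

skipIdx : (m : ℕ) → Fin (suc m) → ℕ
skipIdx m i with toℕ i ≟ m
... | yes _ = suc m
... | no _ = toℕ i

module _ {ℓ : Level} {τ : Signature ℓ} (C : CloneStr τ) where
  open CloneStr C

  -- a is independent of e_{m+1} (paper's 𝖾_n with n = m + 1)
  Independent : Carrier → ℕ → Set ℓ
  Independent a m = q (suc m) a (λ i → e (skipIdx m i)) ≈ a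

  FiniteDim : Carrier → Set ℓ
  FiniteDim a = ∃ λ N → ∀ m → N ≤ m → Independent a m

IsFiCA : {ℓ : Level} {τ : Signature ℓ} → CloneStr τ → Set ℓ
IsFiCA C = IsCA C × (∀ a → FiniteDim C a)

module _ {ℓ : Level} {τ : Signature ℓ} (A : Algebra τ) where
  private module A = Algebra A
  open A using (Carrier; _≈_)

  Seq : Set ℓ
  Seq = ℕ → Carrier

  _≋_ : Seq → Seq → Set ℓ
  s ≋ t = ∀ i → s i ≈ t i

  upd : ∀ {n} → Seq → (Fin n → Carrier) → Seq
  upd {n} s v i with i <? n
  ... | yes p = v (fromℕ< p)
  ... | no _ = s i

  upd-cong : ∀ {n} {s t : Seq} {v w : Fin n → Carrier} →
             s ≋ t → (∀ j → v j ≈ w j) → upd s v ≋ upd t w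
  upd-cong {n} s≋t v≈w i with i <? n
  ... | yes p = v≈w (fromℕ< p)
  ... | no _ = s≋t i

  FunEl : Set ℓ
  FunEl = Σ (Seq → Carrier) λ φ → ∀ {s t} → s ≋ t → φ s ≈ φ t

  Full : CloneStr τ
  Full = record
    { alg = record
      { Carrier = FunEl
      ; _≈_ = λ φ ψ → ∀ s → proj₁ φ s ≈ proj₁ ψ s
      ; isEquivalence = record
        { refl = λ s → A.refl
        ; sym = λ p s → A.sym (p s)
        ; trans = λ p r s → A.trans (p s) (r s) }
      ; ⟦_⟧ = λ f ψs → (λ s → A.⟦ f ⟧ (λ j → proj₁ (ψs j) s))
                     , (λ s≋t → A.⟦⟧-cong f (λ j → proj₂ (ψs j) s≋t))
      ; ⟦⟧-cong = λ f eq s → A.⟦⟧-cong f (λ j → eq j s) }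
    ; q = λ n φ ψs → (λ s → proj₁ φ (upd s (λ j → proj₁ (ψs j) s)))
                   , (λ s≋t → proj₂ φ (upd-cong s≋t (λ j → proj₂ (ψs j) s≋t)))
    ; q-cong = λ n {φ} {φ'} {ψs} {ψs'} φ≈ ψ≈ s →
        A.trans (φ≈ (upd s (λ j → proj₁ (ψs j) s)))
                (proj₂ φ' (upd-cong (λ i → A.refl) (λ j → ψ≈ j s)))
    ; e = λ i → (λ s → s i) , (λ s≋t → s≋t i) }

  Cof : Seq → Seq → Set ℓ
  Cof r s = ∃ λ N → ∀ i → N ≤ i → s i ≈ r i

  upd-cof : ∀ {n} {r s : Seq} (v : Fin n → Carrier) → Cof r s → Cof r (upd s v)
  upd-cof {n} {r} {s} v (N , c) = n + N , h
    where
    h : ∀ i → n + N ≤ i → upd s v i ≈ r i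
    h i le with i <? n
    ... | yes p = ⊥-elim (<⇒≱ p (≤-trans (Data.Nat.Properties.m≤m+n n N) le))
    ... | no _ = c i (≤-trans (m≤n+m N n) le)

  Dom : Seq → Set ℓ
  Dom r = Σ Seq (Cof r)

  RFunEl : Seq → Set ℓ
  RFunEl r = Σ (Dom r → Carrier) λ φ → ∀ {s t} → proj₁ s ≋ proj₁ t → φ s ≈ φ t

  FullR : Seq → CloneStr τ
  FullR r = record
    { alg = record
      { Carrier = RFunEl r
      ; _≈_ = λ φ ψ → ∀ s → proj₁ φ s ≈ proj₁ ψ s
      ; isEquivalence = record
        { refl = λ s → A.refl
        ; sym = λ p s → A.sym (p s)
        ; trans = λ p r s → A.trans (p s) (r s) }
      ; ⟦_⟧ = λ f ψs → (λ s → A.⟦ f ⟧ (λ j → proj₁ (ψs j) s))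
                     , (λ s≋t → A.⟦⟧-cong f (λ j → proj₂ (ψs j) s≋t))
      ; ⟦⟧-cong = λ f eq s → A.⟦⟧-cong f (λ j → eq j s) }
    ; q = λ n φ ψs →
        (λ s → proj₁ φ ( upd (proj₁ s) (λ j → proj₁ (ψs j) s)
                       , upd-cof (λ j → proj₁ (ψs j) s) (proj₂ s)))
        , (λ s≋t → proj₂ φ (upd-cong s≋t (λ j → proj₂ (ψs j) s≋t)))
    ; q-cong = λ n {φ} {φ'} {ψs} {ψs'} φ≈ ψ≈ s →
        A.trans (φ≈ _) (proj₂ φ' (upd-cong (λ i → A.refl) (λ j → ψ≈ j s)))
    ; e = λ i → (λ s → proj₁ s i) , (λ s≋t → s≋t i) }

  IsTop : FunEl → Set ℓ
  IsTop φ = ∃ λ k → Σ ((Fin k → Carrier) → Carrier) λ f →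
            ∀ s → proj₁ φ s ≈ f (λ i → s (toℕ i))

module _ {ℓ : Level} {τ : Signature ℓ} (B : CloneStr τ) where
  open CloneStr B

  record Closed (P : Carrier → Set ℓ) : Set ℓ where
    field
      op-closed : ∀ f xs → (∀ i → P (xs i)) → P (⟦ f ⟧ xs)
      q-closed : ∀ n x xs → P x → (∀ i → P (xs i)) → P (q n x xs)
      e-closed : ∀ i → P (e i)

  Sub : (P : Carrier → Set ℓ) → Closed P → CloneStr τ
  Sub P cl = record
    { alg = record
      { Carrier = Σ Carrier P
      ; _≈_ = λ x y → proj₁ x ≈ proj₁ y
      ; isEquivalence = record { refl = refl ; sym = sym ; trans = trans }
      ; ⟦_⟧ = λ f xs → ⟦ f ⟧ (λ i → proj₁ (xs i))
                     , Closed.op-closed cl f _ (λ i → proj₂ (xs i))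
      ; ⟦⟧-cong = λ f eq → ⟦⟧-cong f eq }
    ; q = λ n x xs → q n (proj₁ x) (λ i → proj₁ (xs i))
                   , Closed.q-closed cl n _ _ (proj₂ x) (λ i → proj₂ (xs i))
    ; q-cong = λ n eq eqs → q-cong n eq eqs
    ; e = λ i → e i , Closed.e-closed cl i }

record Hom {ℓ : Level} {τ : Signature ℓ} (B C : CloneStr τ) : Set ℓ where
  private
    module B = CloneStr B
    module C = CloneStr C
  field
    h : B.Carrier → C.Carrier
    h-cong : ∀ {x y} → x B.≈ y → h x C.≈ h y
    h-op : ∀ f xs → h (B.⟦ f ⟧ xs) C.≈ C.⟦ f ⟧ (λ i → h (xs i))
    h-q : ∀ n x xs → h (B.q n x xs) C.≈ C.q n (h x) (λ i → h (xs i))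
    h-e : ∀ i → h (B.e i) C.≈ C.e i

module _ {ℓ : Level} {τ : Signature ℓ} {B C : CloneStr τ} where
  private
    module B = CloneStr B
    module C = CloneStr C

  Surjective : Hom B C → Set ℓ
  Surjective φ = ∀ y → ∃ λ x → Hom.h φ x C.≈ y

  Injective : Hom B C → Set ℓ
  Injective φ = ∀ {x y} → Hom.h φ x C.≈ Hom.h φ y → x B.≈ y

_≅_ : {ℓ : Level} {τ : Signature ℓ} → CloneStr τ → CloneStr τ → Set ℓ
B ≅ C = Σ (Hom B C) λ φ → Injective φ × Surjective φ

Π : {ℓ : Level} {τ : Signature ℓ} {I : Set ℓ} → (I → CloneStr τ) → CloneStr τ
Π {I = I} B = record
  { alg = record
    { Carrier = ∀ i → CloneStr.Carrier (B i)
    ; _≈_ = λ x y → ∀ i → CloneStr._≈_ (B i) (x i) (y i)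
    ; isEquivalence = record
      { refl = λ i → CloneStr.refl (B i)
      ; sym = λ p i → CloneStr.sym (B i) (p i)
      ; trans = λ p r i → CloneStr.trans (B i) (p i) (r i) }
    ; ⟦_⟧ = λ f xs i → CloneStr.⟦_⟧ (B i) f (λ j → xs j i)
    ; ⟦⟧-cong = λ f eq i → CloneStr.⟦⟧-cong (B i) f (λ j → eq j i) }
  ; q = λ n x xs i → CloneStr.q (B i) n (x i) (λ j → xs j i)
  ; q-cong = λ n eq eqs i → CloneStr.q-cong (B i) n (eq i) (λ j → eqs j i)
  ; e = λ k i → CloneStr.e (B i) k }

module _ {ℓ : Level} {τ : Signature ℓ} where

  IRCA : CloneStr τ → Set (lsuc ℓ)
  IRCA C = Σ (Algebra τ) λ A → Σ (Seq A) λ r →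
           Σ (CloneStr.Carrier (FullR A r) → Set ℓ) λ P →
           Σ (Closed (FullR A r) P) λ cl → Sub (FullR A r) P cl ≅ C

  IFCA : CloneStr τ → Set (lsuc ℓ)
  IFCA C = Σ (Algebra τ) λ A →
           Σ (CloneStr.Carrier (Full A) → Set ℓ) λ P →
           Σ (Closed (Full A) P) λ cl → Sub (Full A) P cl ≅ C

  IBLK : CloneStr τ → Set (lsuc ℓ)
  IBLK C = Σ (Algebra τ) λ A →
           Σ (CloneStr.Carrier (Full A) → Set ℓ) λ P →
           Σ (Closed (Full A) P) λ cl →
           (∀ φ → P φ → IsTop A φ) × (Sub (Full A) P cl ≅ C)

  module _ {k : Level} (K : CloneStr τ → Set k) where
    ℍ : CloneStr τ → Set (lsuc ℓ ⊔ k)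
    ℍ C = Σ (CloneStr τ) λ B → K B × Σ (Hom B C) Surjective

    𝕊 : CloneStr τ → Set (lsuc ℓ ⊔ k)
    𝕊 C = Σ (CloneStr τ) λ B → K B ×
          Σ (CloneStr.Carrier B → Set ℓ) λ P →
          Σ (Closed B P) λ cl → Sub B P cl ≅ C

    ℙ : CloneStr τ → Set (lsuc ℓ ⊔ k)
    ℙ C = Σ (Set ℓ) λ I → Σ (I → CloneStr τ) λ B →
          (∀ i → K (B i)) × (Π B ≅ C)

  HSP : {k : Level} → (CloneStr τ → Set k) → CloneStr τ → Set (lsuc ℓ ⊔ k)
  HSP K = ℍ (𝕊 (ℙ K))

{-# OPTIONS --safe #-}
-- By q-pad, C acts on the sequences s that are eventually e: x sends s to q n x (s₀ , … , s_{n-1})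
-- for n large.  This embeds C into the point-relativized clone algebra with thread e.
--
-- For an action on all sequences, take infinitary terms over C modulo the congruence ≈∞
-- generated by the identities required of such an action; one has to show that
-- app x var ≈∞ app y var implies x ≈ y.  By recursion on a derivation of ≈∞, its conclusion
-- holds in some stage: a partial congruence obtained from evaluation in C by repeatedly letting
-- C act on all sequences of defined terms, with unions of chains in order to pass to the
-- infinitely many premises of app-congruence.  Each such step identifies no two old terms.
-- This replaces the classical choice of representatives in an ultrapower.
--
-- C is a quotient of the algebra of those sequences of top extensions on C that coincide, from
-- some index on, with the sequence of the functions s ↦ q k x (s₀ , … , s_{k-1}).
module Submission where

open import Defs
open import Level using (Level; Lift; lift) renaming (suc to lsuc)
open import Data.Nat using (ℕ; zero; suc; _+_; _⊔_; _≤_; _≤′_; ≤′-reflexive; ≤′-step; _<_; _<?_; _≟_)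
open import Data.Nat.Properties
  using (≤-trans; ≤-refl; ≤-total; m≤m+n; m≤n+m; <⇒≱; ≮⇒≥; <-≤-trans; m≤m⊔n; m≤n⊔m; +-monoʳ-≤
        ; m≤n⇒∃[o]m+o≡n; +-identityʳ; ≤-<-connex; m≤n⇒m≤1+n; <-irrefl; ≤⇒≤′)
open import Data.Fin using (Fin; zero; suc; toℕ; fromℕ<; _↑ˡ_; _↑ʳ_; splitAt)
open import Data.Fin.Properties
  using (toℕ<n; toℕ-fromℕ<; fromℕ<-toℕ; toℕ-↑ˡ; toℕ-↑ʳ; splitAt⁻¹-↑ˡ; splitAt⁻¹-↑ʳ)
open import Data.Vec.Functional using (_++_)
open import Data.Vec.Functional.Properties using (lookup-++ˡ; lookup-++ʳ)
open import Data.Product using (Σ; ∃; _×_; _,_; proj₁; proj₂)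
open import Data.Sum using (_⊎_; inj₁; inj₂)
open import Data.Unit.Polymorphic using (⊤; tt)
open import Data.Empty using (⊥-elim)
open import Function using (_∘_)
open import Function.Bundles using (_⇔_; mk⇔)
open import Relation.Nullary using (yes; no)
open import Relation.Binary.PropositionalEquality as ≡ using (_≡_)

private variable
  ℓ a : Level
  τ : Signature ℓ

-- Sequences and their finite modifications

module _ {X : Set a} where

  -- `upd` over a bare type: `q∞` needs it for threads of terms, before the terms form an algebra.
  overwrite : ∀ {n} → (ℕ → X) → (Fin n → X) → ℕ → X
  overwrite {n} s v i with i <? n
  ... | yes p = v (fromℕ< p)
  ... | no _ = s i

  overwrite-< : ∀ {n} (s : ℕ → X) (v : Fin n → X) {i} (p : i < n) →
                overwrite s v i ≡ v (fromℕ< p)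
  overwrite-< {n} s v {i} p with i <? n
  ... | yes _ = ≡.refl
  ... | no ¬p = ⊥-elim (¬p p)

  overwrite-≥ : ∀ {n} (s : ℕ → X) (v : Fin n → X) {i} → n ≤ i → overwrite s v i ≡ s i
  overwrite-≥ {n} s v {i} n≤i with i <? n
  ... | yes p = ⊥-elim (<⇒≱ p n≤i)
  ... | no _ = ≡.refl

  overwrite-toℕ : ∀ {n} (s : ℕ → X) (v : Fin n → X) j → overwrite s v (toℕ j) ≡ v j
  overwrite-toℕ s v j =
    ≡.trans (overwrite-< s v (toℕ<n j)) (≡.cong v (fromℕ<-toℕ j (toℕ<n j)))

  truncate : (ℕ → X) → ℕ → (ℕ → X) → ℕ → X
  truncate r k s = overwrite {n = k} r (s ∘ toℕ)

  truncate-< : ∀ (r : ℕ → X) {k} s {i} → i < k → truncate r k s i ≡ s i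
  truncate-< r s i<k = ≡.trans (overwrite-< r _ i<k) (≡.cong s (toℕ-fromℕ< i<k))

  truncate-≥ : ∀ (r : ℕ → X) {k} s {i} → k ≤ i → truncate r k s i ≡ r i
  truncate-≥ r s = overwrite-≥ r _

module _ {ℓ} {τ : Signature ℓ} (A : Algebra τ) where
  private module A = Algebra A

  upd≡overwrite : ∀ {n} (s : Seq A) (v : Fin n → A.Carrier) i →
                  upd A s v i ≡ overwrite s v i
  upd≡overwrite {n} s v i with i <? n
  ... | yes _ = ≡.refl
  ... | no _ = ≡.refl

  upd-≥ : ∀ {n} (s : Seq A) (v : Fin n → A.Carrier) {i} → n ≤ i → upd A s v i ≡ s i
  upd-≥ s v {i} n≤i = ≡.trans (upd≡overwrite s v i) (overwrite-≥ s v n≤i)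

  upd-toℕ : ∀ {n} (s : Seq A) (v : Fin n → A.Carrier) j → upd A s v (toℕ j) ≡ v j
  upd-toℕ s v j = ≡.trans (upd≡overwrite s v (toℕ j)) (overwrite-toℕ s v j)

  -- An updated sequence is determined by its two segments. The three laws that follow, which are
  -- behind `q-unit`, `q-assoc` and `q-pad`, are instances.
  upd-ext : ∀ {n} (s t : Seq A) (v : Fin n → A.Carrier) →
            (∀ j → t (toℕ j) A.≈ v j) → (∀ i → n ≤ i → t i A.≈ s i) → _≋_ A (upd A s v) t
  upd-ext {n} s t v lo hi i with i <? n
  ... | yes p = A.trans (A.sym (lo (fromℕ< p)))
                        (A.reflexive (≡.cong t (toℕ-fromℕ< p)))
  ... | no ¬p = A.sym (hi i (≮⇒≥ ¬p))

  upd-unit : ∀ n (s : Seq A) → _≋_ A (upd A s (λ (j : Fin n) → s (toℕ j))) s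
  upd-unit n s = upd-ext {n} s s _ (λ _ → A.refl) (λ _ _ → A.refl)

  upd-upd : ∀ n (s : Seq A) (v w : Fin n → A.Carrier) →
            _≋_ A (upd A (upd A s v) w) (upd A s w)
  upd-upd n s v w = upd-ext (upd A s v) (upd A s w) w
    (λ j → A.reflexive (upd-toℕ s w j))
    (λ i n≤i → A.reflexive (≡.trans (upd-≥ s w n≤i) (≡.sym (upd-≥ s v n≤i))))

  upd-pad : ∀ {k} m (s : Seq A) (v : Fin k → A.Carrier) (w : Fin (k + m) → A.Carrier) →
            (∀ j → w (j ↑ˡ m) A.≈ v j) → (∀ j → w (k ↑ʳ j) A.≈ s (k + toℕ j)) →
            _≋_ A (upd A s v) (upd A s w)
  upd-pad {k} m s v w lo hi = upd-ext s (upd A s w) v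
    (λ j → A.trans (A.reflexive (≡.trans (≡.cong (upd A s w) (≡.sym (toℕ-↑ˡ j m))) (upd-toℕ s w (j ↑ˡ m)))) (lo j))
    tail
    where
    tail : ∀ i → k ≤ i → upd A s w i A.≈ s i
    tail i k≤i with m≤n⇒∃[o]m+o≡n k≤i
    -- The index is k + o: in the second block of `w` if o < m, outside `w` otherwise.
    ... | o , ≡.refl with o <? m
    ... | no ¬p = A.reflexive (upd-≥ s w (+-monoʳ-≤ k (≮⇒≥ ¬p)))
    ... | yes p = A.trans (A.reflexive (≡.trans (≡.cong (upd A s w) (≡.sym eq)) (upd-toℕ s w (k ↑ʳ fromℕ< p))))
                  (A.trans (hi (fromℕ< p)) (A.reflexive (≡.cong (λ x → s (k + x)) (toℕ-fromℕ< p))))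
      where
      eq : toℕ (k ↑ʳ fromℕ< p) ≡ k + o
      eq = ≡.trans (toℕ-↑ʳ k (fromℕ< p)) (≡.cong (k +_) (toℕ-fromℕ< p))

-- The identities of clone algebras

module _ {ℓ} {τ : Signature ℓ} (A : Algebra τ) where
  private module A = Algebra A

  Full-isCA : IsCA (Full A)
  Full-isCA = record
    { q-e-proj = λ n i xs s → A.reflexive (upd-toℕ A s _ i)
    ; q-e-out = λ n j n≤j xs s → A.reflexive (upd-≥ A s _ n≤j)
    ; q-unit = λ n x s → proj₂ x (upd-unit A n s)
    ; q-pad = λ k m x ys s → proj₂ x (upd-pad A (suc m) s _ _
        (λ j → A.reflexive (≡.cong (λ y → proj₁ y s) (lookup-++ˡ ys _ j)))
        (λ j → A.reflexive (≡.cong (λ y → proj₁ y s) (lookup-++ʳ ys _ j))))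
    ; q-assoc = λ n x ys zs s → proj₂ x (upd-upd A n s _ _)
    ; q-op = λ f xs n ys s → A.refl }

  FullR-isCA : ∀ r → IsCA (FullR A r)
  FullR-isCA r = record
    { q-e-proj = λ n i xs s → A.reflexive (upd-toℕ A (proj₁ s) _ i)
    ; q-e-out = λ n j n≤j xs s → A.reflexive (upd-≥ A (proj₁ s) _ n≤j)
    ; q-unit = λ n x s → proj₂ x (upd-unit A n (proj₁ s))
    ; q-pad = λ k m x ys s → proj₂ x (upd-pad A (suc m) (proj₁ s) _ _
        (λ j → A.reflexive (≡.cong (λ y → proj₁ y s) (lookup-++ˡ ys _ j)))
        (λ j → A.reflexive (≡.cong (λ y → proj₁ y s) (lookup-++ʳ ys _ j))))
    ; q-assoc = λ n x ys zs s → proj₂ x (upd-upd A n (proj₁ s) _ _)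
    ; q-op = λ f xs n ys s → A.refl }

-- Every argument is rewritten as the image of its chosen preimage, the identity is applied in B,
-- and `h` is pushed inwards again. Only `lifts` is asked of `pre`; it need not respect equality.
surjective-isCA : {B C : CloneStr τ} (φ : Hom B C) → Surjective φ → IsCA B → IsCA C
surjective-isCA {B = B} {C} φ surj caB = record
  { q-e-proj = λ n i xs →
      trans (q-cong n (sym (h-e (toℕ i))) (unlift xs)) (trans (sym (h-q n _ (pre ∘ xs)))
        (trans (h-cong (CA.q-e-proj n i (pre ∘ xs))) (lifts (xs i))))
  ; q-e-out = λ n j n≤j xs →
      trans (q-cong n (sym (h-e j)) (unlift xs)) (trans (sym (h-q n _ (pre ∘ xs)))
        (trans (h-cong (CA.q-e-out n j n≤j (pre ∘ xs))) (h-e j)))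
  ; q-unit = λ n x →
      trans (q-cong n (sym (lifts x)) (λ i → sym (h-e (toℕ i)))) (trans (sym (h-q n _ _))
        (trans (h-cong (CA.q-unit n _)) (lifts x)))
  ; q-pad = λ k m x ys →
      trans (q-cong k (sym (lifts x)) (unlift ys)) (trans (sym (h-q k _ (pre ∘ ys)))
        (trans (h-cong (CA.q-pad k m _ (pre ∘ ys))) (trans (h-q (k + suc m) _ _)
          (q-cong (k + suc m) (lifts x) (pad k m ys)))))
  ; q-assoc = λ n x ys zs →
      trans (q-cong n (trans (q-cong n (sym (lifts x)) (unlift ys)) (sym (h-q n _ (pre ∘ ys))))
                      (unlift zs))
        (trans (sym (h-q n _ (pre ∘ zs))) (trans (h-cong (CA.q-assoc n _ (pre ∘ ys) (pre ∘ zs)))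
          (trans (h-q n _ _) (q-cong n (lifts x) (λ i →
            trans (h-q n (pre (ys i)) (pre ∘ zs)) (q-cong n (lifts (ys i)) (lifts ∘ zs)))))))
  ; q-op = λ f xs n ys →
      trans (q-cong n (trans (⟦⟧-cong f (unlift xs)) (sym (h-op f (pre ∘ xs)))) (unlift ys))
        (trans (sym (h-q n _ (pre ∘ ys))) (trans (h-cong (CA.q-op f (pre ∘ xs) n (pre ∘ ys)))
          (trans (h-op f _) (⟦⟧-cong f (λ i →
            trans (h-q n (pre (xs i)) (pre ∘ ys)) (q-cong n (lifts (xs i)) (lifts ∘ ys))))))) }
  where
  module B = CloneStr B
  module CA = IsCA caB
  open CloneStr C
  open Hom φ
  pre : Carrier → B.Carrier
  pre x = surj x .proj₁
  lifts : ∀ x → h (pre x) ≈ x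
  lifts x = surj x .proj₂
  unlift : ∀ {n} (xs : Fin n → Carrier) i → xs i ≈ h (pre (xs i))
  unlift xs i = sym (lifts (xs i))
  -- `_++_` is stuck on `splitAt`, so `h` passes through it only after a case split.
  pad : ∀ k m (ys : Fin k → Carrier) i →
        h (((pre ∘ ys) ++ (λ (j : Fin (suc m)) → B.e (k + toℕ j))) i)
        ≈ (ys ++ (λ j → e (k + toℕ j))) i
  pad k m ys i with splitAt k i
  ... | inj₁ j = lifts (ys j)
  ... | inj₂ j = h-e (k + toℕ j)

Sub-isCA : (B : CloneStr τ) (P : CloneStr.Carrier B → Set _) (cl : Closed B P) →
           IsCA B → IsCA (Sub B P cl)
Sub-isCA B P cl ca = record
  { q-e-proj = λ n i xs → q-e-proj n i (proj₁ ∘ xs)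
  ; q-e-out = λ n j n≤j xs → q-e-out n j n≤j (proj₁ ∘ xs)
  ; q-unit = λ n x → q-unit n (proj₁ x)
  ; q-pad = λ k m x ys → trans (q-pad k m (proj₁ x) (proj₁ ∘ ys)) (q-cong (k + suc m) refl (pad k m ys))
  ; q-assoc = λ n x ys zs → q-assoc n (proj₁ x) (proj₁ ∘ ys) (proj₁ ∘ zs)
  ; q-op = λ f xs n ys → q-op f (proj₁ ∘ xs) n (proj₁ ∘ ys) }
  where
  open CloneStr B
  open IsCA ca
  pad : ∀ k m (ys : Fin k → CloneStr.Carrier (Sub B P cl)) i →
        (((proj₁ ∘ ys) ++ (λ (j : Fin (suc m)) → e (k + toℕ j))) i)
        ≈ proj₁ ((ys ++ (λ j → CloneStr.e (Sub B P cl) (k + toℕ j))) i)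
  pad k m ys i with splitAt k i
  ... | inj₁ j = refl
  ... | inj₂ j = refl

Π-isCA : {I : Set ℓ} {τ : Signature ℓ} (B : I → CloneStr τ) → (∀ i → IsCA (B i)) → IsCA (Π B)
Π-isCA B ca = record
  { q-e-proj = λ n j xs i → q-e-proj (ca i) n j (λ k → xs k i)
  ; q-e-out = λ n j n≤j xs i → q-e-out (ca i) n j n≤j (λ k → xs k i)
  ; q-unit = λ n x i → q-unit (ca i) n (x i)
  ; q-pad = λ k m x ys i → let open CloneStr (B i) in
      trans (q-pad (ca i) k m (x i) (λ j → ys j i)) (q-cong (k + suc m) refl (pad k m ys i))
  ; q-assoc = λ n x ys zs i → q-assoc (ca i) n (x i) (λ j → ys j i) (λ j → zs j i)
  ; q-op = λ f xs n ys i → q-op (ca i) f (λ j → xs j i) n (λ j → ys j i) }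
  where
  open IsCA
  pad : ∀ k m (ys : Fin k → CloneStr.Carrier (Π B)) i l → let open CloneStr (B i) in
        ((λ j → ys j i) ++ (λ (j : Fin (suc m)) → e (k + toℕ j))) l
        ≈ (ys ++ (λ j → CloneStr.e (Π B) (k + toℕ j))) l i
  pad k m ys i l with splitAt k l
  ... | inj₁ j = CloneStr.refl (B i)
  ... | inj₂ j = CloneStr.refl (B i)

HSP-isCA : ∀ {k} {K : CloneStr τ → Set k} → (∀ {B} → K B → IsCA B) →
           ∀ {C} → HSP K C → IsCA C
HSP-isCA K⊆CA (_ , (_ , (_ , Bs , KBs , φ , _ , φ-surj) , P , cl , ψ , _ , ψ-surj) , χ , χ-surj) =
  surjective-isCA χ χ-surj (surjective-isCA ψ ψ-surj (Sub-isCA _ P cl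
    (surjective-isCA φ φ-surj (Π-isCA Bs (λ i → K⊆CA (KBs i))))))

-- Isomorphisms and images of homomorphisms

≅-refl : (C : CloneStr τ) → C ≅ C
≅-refl C = record { h = λ x → x ; h-cong = λ p → p ; h-op = λ _ _ → refl
                  ; h-q = λ _ _ _ → refl ; h-e = λ _ → refl }
         , (λ p → p) , (λ y → y , refl)
  where open CloneStr C

module _ {ℓ} {τ : Signature ℓ} {C D : CloneStr τ} (φ : Hom C D) where
  private
    module C = CloneStr C
    module D = CloneStr D
  open Hom φ

  Image : D.Carrier → Set ℓ
  Image d = ∃ λ c → d D.≈ h c

  Image-closed : Closed D Image
  Image-closed = record
    { op-closed = λ f xs im → C.⟦ f ⟧ (proj₁ ∘ im)
        , D.trans (D.⟦⟧-cong f (proj₂ ∘ im)) (D.sym (h-op f _))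
    ; q-closed = λ n x xs (c , x≈hc) im → C.q n c (proj₁ ∘ im)
        , D.trans (D.q-cong n x≈hc (proj₂ ∘ im)) (D.sym (h-q n c _))
    ; e-closed = λ i → C.e i , D.sym (h-e i) }

  -- An element of the image carries a preimage, so the inverse of `φ` is a projection; injectivity
  -- makes it respect equality.
  Image-≅ : Injective φ → Sub D Image Image-closed ≅ C
  Image-≅ inj = record
    { h = λ (_ , c , _) → c
    ; h-cong = λ {(_ , c , p)} {(_ , d , r)} x≈y → inj (D.trans (D.sym p) (D.trans x≈y r))
    ; h-op = λ _ _ → C.refl ; h-q = λ _ _ _ → C.refl ; h-e = λ _ → C.refl }
    , (λ {(_ , c , p)} {(_ , d , r)} c≈d → D.trans p (D.trans (h-cong c≈d) (D.sym r)))
    , (λ c → (h c , c , D.refl) , C.refl)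

-- The action of a clone algebra on sequences that are eventually `e`

module Action {ℓ} {τ : Signature ℓ} (C : CloneStr τ) (isCA : IsCA C) where
  open CloneStr C
  open IsCA isCA

  -- Padding by constants, which the entries from M on equal. This frees `act` from the particular
  -- bound stored in its argument.
  q-extend : ∀ {M N} → M ≤ N → ∀ x (s : Seq alg) → (∀ i → M ≤ i → s i ≈ e i) →
             q M x (s ∘ toℕ) ≈ q N x (s ∘ toℕ)
  q-extend {M} M≤N x s s≈e with m≤n⇒∃[o]m+o≡n M≤N
  ... | zero , eq = reflexive (≡.cong (λ n → q n x (s ∘ toℕ)) (≡.trans (≡.sym (+-identityʳ M)) eq))
  ... | suc m , ≡.refl = trans (q-pad M m x (s ∘ toℕ)) (q-cong (M + suc m) refl pad)
    where
    pad : ∀ i → ((s ∘ toℕ) ++ (λ (j : Fin (suc m)) → e (M + toℕ j))) i ≈ s (toℕ i)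
    pad i with splitAt M i in eq
    ... | inj₁ j = reflexive (≡.cong s (≡.trans (≡.sym (toℕ-↑ˡ j (suc m))) (≡.cong toℕ (splitAt⁻¹-↑ˡ eq))))
    ... | inj₂ j = trans (sym (s≈e _ (m≤m+n M _)))
                         (reflexive (≡.cong s (≡.trans (≡.sym (toℕ-↑ʳ M j)) (≡.cong toℕ (splitAt⁻¹-↑ʳ eq)))))

  act : Carrier → Dom alg e → Carrier
  act x (s , N , _) = q N x (s ∘ toℕ)

  act-cong : ∀ {x y} → x ≈ y → {s t : Dom alg e} → (∀ i → proj₁ s i ≈ proj₁ t i) → act x s ≈ act y t
  act-cong x≈y {s , N , s≈e} {t , M , t≈e} s≈t with ≤-total N M
  ... | inj₁ N≤M = trans (q-extend N≤M _ s s≈e) (q-cong M x≈y (s≈t ∘ toℕ))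
  ... | inj₂ M≤N = trans (q-cong N x≈y (s≈t ∘ toℕ)) (sym (q-extend M≤N _ t t≈e))

  act-thread : ∀ x (s : Dom alg e) → (∀ i → proj₁ s i ≈ e i) → act x s ≈ x
  act-thread x s s≈e = trans (act-cong refl {s} {e , 0 , λ _ _ → refl} s≈e) (q-unit 0 x)

  act-e : ∀ i (s : Dom alg e) → act (e i) s ≈ proj₁ s i
  act-e i (s , N , s≈e) with i <? N
  ... | no i≮N = trans (q-e-out N i (≮⇒≥ i≮N) _) (sym (s≈e i (≮⇒≥ i≮N)))
  ... | yes i<N = ≡.subst (λ k → q N (e k) (s ∘ toℕ) ≈ s k) (toℕ-fromℕ< i<N) (q-e-proj N (fromℕ< i<N) _)

  -- `q-assoc` wants equal arities, so `ys` is padded by constants and everything is read in arity n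
  -- + N. The sequence `t` is left free because `toFullR` presents it by `upd` and `base` by
  -- `overwrite`.
  act-q : ∀ n x (ys : Fin n → Carrier) (s t : Dom alg e) →
          (∀ i → overwrite (proj₁ s) (λ j → act (ys j) s) i ≈ proj₁ t i) →
          act (q n x ys) s ≈ act x t
  act-q n x ys s@(s′ , N , s≈e) t eq =
    trans (q-extend (m≤n+m N n) _ s′ s≈e)
    (trans (q-cong M (trans (q-cong n refl (λ j → reflexive (≡.sym (overwrite-toℕ e ys j))))
                            (q-extend (m≤m+n n N) x padded
                               (λ i n≤i → reflexive (overwrite-≥ e ys n≤i))))
                     (λ _ → refl))
    (trans (q-assoc M x (padded ∘ toℕ) (s′ ∘ toℕ))
    (trans (q-cong M refl (λ i → component (toℕ i) (toℕ<n i)))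
           (act-cong refl {updated , M , λ i M≤i →
              trans (reflexive (overwrite-≥ s′ _ (≤-trans (m≤m+n n N) M≤i)))
                    (s≈e i (≤-trans (m≤n+m N n) M≤i))} {t} eq))))
    where
    M = n + N
    padded = overwrite e ys
    updated = overwrite s′ (λ j → act (ys j) s)
    component : ∀ i → i < M → q M (padded i) (s′ ∘ toℕ) ≈ updated i
    component i i<M with i <? n
    ... | yes i<n = sym (q-extend (m≤n+m N n) _ s′ s≈e)
    ... | no _ = act-e i (s′ , M , λ i M≤i → s≈e i (≤-trans (m≤n+m N n) M≤i))

  act-op : ∀ f (xs : Fin (ar τ f) → Carrier) (s : Dom alg e) →
           act (⟦ f ⟧ xs) s ≈ ⟦ f ⟧ (λ i → act (xs i) s)
  act-op f xs (s , N , _) = q-op f xs N _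

  toFullR : Hom C (FullR alg e)
  toFullR = record
    { h = λ x → act x , λ {s} {t} → act-cong refl {s} {t}
    ; h-cong = λ x≈y s → act-cong x≈y {s} {s} (λ _ → refl)
    ; h-op = λ f xs s → act-op f xs s
    ; h-q = λ n x ys s → act-q n x ys s (_ , upd-cof alg (λ j → act (ys j) s) (proj₂ s)) (λ i → reflexive (≡.sym (upd≡overwrite alg {n} (proj₁ s) _ i)))
    ; h-e = λ i s → act-e i s }

  -- By `act-thread`, x is recovered as the value of `act x` at the thread.
  toFullR-injective : Injective toFullR
  toFullR-injective {x} {y} eq =
    trans (sym (act-thread x thread (λ _ → refl))) (trans (eq thread) (act-thread y thread (λ _ → refl)))
    where
    thread : Dom alg e
    thread = e , 0 , λ _ _ → refl

-- Point-relativized representation, and the inclusions into clone algebras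

CA⇒IRCA : (C : CloneStr τ) → IsCA C → IRCA C
CA⇒IRCA C ca = CloneStr.alg C , CloneStr.e C , Image toFullR , Image-closed toFullR
             , Image-≅ toFullR toFullR-injective
  where open Action C ca

IRCA⇒CA : (C : CloneStr τ) → IRCA C → IsCA C
IRCA⇒CA C (A , r , P , cl , φ , _ , surj) =
  surjective-isCA φ surj (Sub-isCA _ P cl (FullR-isCA A r))

IFCA⇒CA : (C : CloneStr τ) → IFCA C → IsCA C
IFCA⇒CA C (A , P , cl , φ , _ , surj) =
  surjective-isCA φ surj (Sub-isCA _ P cl (Full-isCA A))

IBLK⇒CA : (C : CloneStr τ) → IBLK C → IsCA C
IBLK⇒CA C (A , P , cl , _ , iso) = IFCA⇒CA C (A , P , cl , iso)

-- The block algebra of all finitary operations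

module Blocks {ℓ} {τ : Signature ℓ} (A : Algebra τ) where
  private
    module A = Algebra A
    module F = CloneStr (Full A)

  -- IsTop does not imply FinitaryAt: without function extensionality, the operation that
  -- IsTop provides need not respect pointwise equality of its arguments.
  FinitaryAt : ℕ → FunEl A → Set ℓ
  FinitaryAt K φ = ∀ s t → (∀ i → i < K → s i A.≈ t i) → proj₁ φ s A.≈ proj₁ φ t

  Finitary : FunEl A → Set ℓ
  Finitary φ = ∃ λ K → FinitaryAt K φ

  finitary-mono : ∀ {K L φ} → K ≤ L → FinitaryAt K φ → FinitaryAt L φ
  finitary-mono K≤L fin s t s≈t = fin s t (λ i i<K → s≈t i (<-≤-trans i<K K≤L))

  commonBound : ∀ {n} (φs : Fin n → FunEl A) → (∀ j → Finitary (φs j)) →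
                ∃ λ K → ∀ j → FinitaryAt K (φs j)
  commonBound {zero} φs fin = 0 , λ ()
  commonBound {suc n} φs fin with fin zero | commonBound (φs ∘ suc) (fin ∘ suc)
  ... | K , f₀ | L , f = K ⊔ L , λ
    { zero → finitary-mono {φ = φs zero} (m≤m⊔n K L) f₀
    ; (suc j) → finitary-mono {φ = φs (suc j)} (m≤n⊔m K L) (f j) }

  finitary-closed : Closed (Full A) Finitary
  finitary-closed = record
    { op-closed = λ f φs fin → let (K , b) = commonBound φs fin in
        K , λ s t s≈t → A.⟦⟧-cong f (λ j → b j s t s≈t)
    -- `φ` reads L entries of the updated sequence; each is an old entry below L or a value that
    -- depends on the first K entries.
    ; q-closed = λ n φ φs (L , c) fin → let (K , b) = commonBound φs fin in
        L ⊔ K , λ s t s≈t → c _ _ (λ i i<L →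
          update s t (λ j → b j s t (λ i i<K → s≈t i (<-≤-trans i<K (m≤n⊔m L K))))
                 (s≈t i (<-≤-trans i<L (m≤m⊔n L K))))
    ; e-closed = λ i → suc i , λ s t s≈t → s≈t i ≤-refl }
    where
    update : ∀ {n} s t {v w : Fin n → A.Carrier} → (∀ j → v j A.≈ w j) →
             ∀ {i} → s i A.≈ t i → upd A s v i A.≈ upd A t w i
    update {n} s t v≈w {i} p with i <? n
    ... | yes _ = v≈w _
    ... | no _ = p

  -- A value at index 0, to be used as filler, exists because the arity is made positive.
  finitary-isTop : ∀ φ → Finitary φ → IsTop A φ
  finitary-isTop φ (K , fin) = suc K , (λ v → proj₁ φ (extend v)) , λ s →
    fin s _ (λ i i<K → A.reflexive (≡.sym (≡.trans (overwrite-< _ _ (m≤n⇒m≤1+n i<K))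
                                     (≡.cong s (toℕ-fromℕ< (m≤n⇒m≤1+n i<K))))))
    where
    extend : (Fin (suc K) → A.Carrier) → Seq A
    extend v = overwrite (λ _ → v zero) v

  -- A single algebra that lies in both generating classes.
  Block : CloneStr τ
  Block = Sub (Full A) Finitary finitary-closed

  Block-isBLK : IBLK Block
  Block-isBLK = A , Finitary , finitary-closed , finitary-isTop , ≅-refl Block

  -- The substitution by `skipIdx m` changes entry m only, and for m ≥ K that entry is not read.
  Block-isFiCA : IsFiCA Block
  Block-isFiCA = Sub-isCA _ _ finitary-closed (Full-isCA A) , λ (φ , K , fin) →
    K , λ m K≤m s → fin _ s (λ i i<K → skip s m i (<-≤-trans i<K K≤m))
    where
    skip : ∀ s m i → i < m → upd A s (λ (j : Fin (suc m)) → s (skipIdx m j)) i A.≈ s i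
    skip s m i i<m with i <? suc m
    ... | no _ = A.refl
    ... | yes p with toℕ (fromℕ< p) ≟ m
    ... | yes eq = ⊥-elim (<-irrefl (≡.trans (≡.sym (toℕ-fromℕ< p)) eq) i<m)
    ... | no _ = A.reflexive (≡.cong s (toℕ-fromℕ< p))

-- Clone algebras as quotients of algebras of convergent sequences

module _ {ℓ} {τ : Signature ℓ} (C : CloneStr τ) (isCA : IsCA C) where
  open CloneStr C
  open IsCA isCA
  open Action C isCA
  open Blocks alg

  private
    Power : CloneStr τ
    Power = Π {I = Lift ℓ ℕ} (λ _ → Block)
    module Pow = CloneStr Power

    approximant : Carrier → Pow.Carrier
    approximant x (lift k) =
      ((λ s → q k x (s ∘ toℕ)) , λ s≈t → q-cong k refl (s≈t ∘ toℕ))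
      , k , λ s t s≈t → q-cong k refl (λ i → s≈t (toℕ i) (toℕ<n i))

  ConvergesFrom : ℕ → Pow.Carrier → Carrier → Set ℓ
  ConvergesFrom N g x = ∀ k → N ≤ k → ∀ s → proj₁ (proj₁ (g (lift k))) s ≈ q k x (s ∘ toℕ)

  Converges : Pow.Carrier → Set ℓ
  Converges g = ∃ λ x → ∃ λ N → ConvergesFrom N g x

  -- By `q-unit`, a late entry of a convergent sequence returns the limit when evaluated at `e`.
  limit-unique : ∀ {g h} ((x , _) : Converges g) ((y , _) : Converges h) → g Pow.≈ h → x ≈ y
  limit-unique (x , N , gx) (y , M , hy) g≈h =
    trans (sym (q-unit (N ⊔ M) x))
    (trans (sym (gx _ (m≤m⊔n N M) e)) (trans (g≈h (lift (N ⊔ M)) e)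
    (trans (hy _ (m≤n⊔m N M) e) (q-unit (N ⊔ M) y))))

  commonIndex : ∀ {n} (gs : Fin n → Pow.Carrier) (c : ∀ j → Converges (gs j)) →
                ∃ λ N → ∀ j → ConvergesFrom N (gs j) (proj₁ (c j))
  commonIndex {zero} gs c = 0 , λ ()
  commonIndex {suc n} gs c with c zero in eq | commonIndex (gs ∘ suc) (c ∘ suc)
  ... | x , K , f₀ | L , f = K ⊔ L , λ
    { zero → ≡.subst (λ c₀ → ConvergesFrom (K ⊔ L) (gs zero) (proj₁ c₀)) (≡.sym eq)
                   (λ k le → f₀ k (≤-trans (m≤m⊔n K L) le))
    ; (suc j) → λ k le → f j k (≤-trans (m≤n⊔m K L) le) }

  converges-closed : Closed Power Converges
  converges-closed = record
    { op-closed = λ f gs c → let (N , b) = commonIndex gs c in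
        ⟦ f ⟧ (proj₁ ∘ c) , N , λ k N≤k s →
          trans (⟦⟧-cong f (λ j → b j k N≤k s)) (sym (q-op f (proj₁ ∘ c) k (s ∘ toℕ)))
    ; q-closed = λ n g gs (x , M , gx) c → let (N , b) = commonIndex gs c in
        q n x (proj₁ ∘ c) , n + (M + N) , λ k le s → compose n g gs x M gx c N b k le s
    ; e-closed = λ i → e i , suc i , λ k i<k s →
        sym (≡.subst (λ j → q k (e j) (s ∘ toℕ) ≈ s j) (toℕ-fromℕ< i<k) (q-e-proj k (fromℕ< i<k) _)) }
    where
    -- The bound asks for k ≥ n, so that `q n x` can be padded to arity k, and for indices beyond
    -- those of `g` and `gs`. Then `q-assoc` in arity k turns composition of operations into `q`.
    compose : ∀ n g gs x M → ConvergesFrom M g x → (c : ∀ (j : Fin n) → Converges (gs j)) →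
              ∀ N → (∀ j → ConvergesFrom N (gs j) (proj₁ (c j))) →
              ConvergesFrom (n + (M + N)) (Pow.q n g gs) (q n x (proj₁ ∘ c))
    compose n g gs x M gx c N b k le s =
      trans (gx k (≤-trans (m≤m+n M N) M+N≤k) _)
      (trans (q-cong k refl (λ i → component (toℕ i) (toℕ<n i)))
      (trans (sym (q-assoc k x (padded ∘ toℕ) (s ∘ toℕ)))
             (q-cong k (sym (trans (q-cong n refl (λ j → reflexive (≡.sym (overwrite-toℕ e (proj₁ ∘ c) j))))
                                   (q-extend n≤k x padded (λ i n≤i → reflexive (overwrite-≥ e _ n≤i)))))
                       (λ _ → refl))))
      where
      n≤k = ≤-trans (m≤m+n n (M + N)) le
      M+N≤k = ≤-trans (m≤n+m (M + N) n) le
      padded = overwrite e (proj₁ ∘ c)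
      component : ∀ i → i < k → upd alg s (λ j → proj₁ (proj₁ (gs j (lift k))) s) i
                                ≈ q k (padded i) (s ∘ toℕ)
      component i i<k with i <? n
      ... | yes p = b (fromℕ< p) k (≤-trans (m≤n+m N M) M+N≤k) s
      ... | no _ = sym (≡.subst (λ j → q k (e j) (s ∘ toℕ) ≈ s j) (toℕ-fromℕ< i<k)
                                (q-e-proj k (fromℕ< i<k) _))

  -- Taking limits is onto, since `approximant x` converges to x from index 0.
  CA⇒HSP : ∀ {k} (K : CloneStr τ → Set k) → K Block → HSP K C
  CA⇒HSP K block = Convergent
    , (Power , (Lift ℓ ℕ , (λ _ → Block) , (λ _ → block) , ≅-refl Power)
             , Converges , converges-closed , ≅-refl Convergent)
    , limit
    , λ x → (approximant x , x , 0 , λ _ _ _ → refl) , refl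
    where
    Convergent : CloneStr τ
    Convergent = Sub Power Converges converges-closed
    limit : Hom Convergent C
    limit = record
      { h = λ (_ , x , _) → x
      ; h-cong = λ {(g , c)} {(h , d)} → limit-unique {g} {h} c d
      ; h-op = λ _ _ → refl ; h-q = λ _ _ _ → refl ; h-e = λ _ → refl }

-- Double negation relative to a goal

module Continuation {ℓ} (R : Set ℓ) where

  -- R stands in for falsity: `decide` is excluded middle in this sense, and a contradiction is an
  -- element of R.
  Cont : Set ℓ → Set ℓ
  Cont X = (X → R) → R

  private variable
    X Y : Set ℓ
    P Q : ℕ → Set ℓ

  return : X → Cont X
  return x r = r x

  infixl 1 _>>=_
  _>>=_ : Cont X → (X → Cont Y) → Cont Y
  (m >>= f) r = m (λ x → f x r)

  decide : (X : Set ℓ) → Cont (X ⊎ (X → R))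
  decide X r = r (inj₂ (λ x → r (inj₁ x)))

  -- Over all of ℕ this would be a double negation shift; hence valuations are consulted finitely
  -- many at a time.
  cont-all : ∀ {n} {X : Fin n → Set ℓ} → (∀ i → Cont (X i)) → Cont (∀ i → X i)
  cont-all {zero} m = return λ ()
  cont-all {suc n} m = do
    x ← m zero
    xs ← cont-all (m ∘ suc)
    return λ { zero → x ; (suc i) → xs i }

  -- Membership in the filter of cofinite sets, up to double negation.
  ◇ : (ℕ → Set ℓ) → Set ℓ
  ◇ P = Cont (Σ ℕ λ N → ∀ k → N ≤ k → P k)

  from : ∀ N → (∀ k → N ≤ k → P k) → ◇ P
  from N p = return (N , p)

  always : (∀ k → P k) → ◇ P
  always p = from 0 (λ k _ → p k)

  infixl 4 _⊛_
  _⊛_ : ◇ (λ k → P k → Q k) → ◇ P → ◇ Q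
  (f ⊛ p) = do
    (N , f) ← f
    (M , p) ← p
    from (N ⊔ M) λ k le → f k (≤-trans (m≤m⊔n N M) le) (p k (≤-trans (m≤n⊔m N M) le))

  ◇-all : ∀ {n} {P : Fin n → ℕ → Set ℓ} → (∀ i → ◇ (P i)) → ◇ (λ k → ∀ i → P i k)
  ◇-all {zero} m = always λ _ ()
  ◇-all {suc n} m =
    always (λ k p ps → λ { zero → p ; (suc i) → ps i }) ⊛ m zero ⊛ ◇-all (m ∘ suc)

-- Infinitary terms, stages and unions of chains

module Infinitary {ℓ} {τ : Signature ℓ} (C : CloneStr τ) where
  private module C = CloneStr C

  data Term : Set ℓ where
    var : ℕ → Term
    app : C.Carrier → (ℕ → Term) → Term
    op : (f : Op τ) → (Fin (ar τ f) → Term) → Term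

  -- A partial equivalence relation on terms, in which app is defined on the threads in Acts only.
  record Stage : Set (lsuc ℓ) where
    infix 4 _~_
    field
      _~_ : Term → Term → Set ℓ
      Acts : (ℕ → Term) → Set ℓ
      ~-sym : ∀ {t u} → t ~ u → u ~ t
      ~-trans : ∀ {t u v} → t ~ u → u ~ v → t ~ v
      acts-dom : ∀ {s} → Acts s → ∀ i → s i ~ s i
      acts-modify : ∀ {s t} N → Acts s → (∀ i → t i ~ t i) → (∀ i → N ≤ i → t i ≡ s i) → Acts t
      acts-var : Acts var
      app-acts : ∀ {a s} → app a s ~ app a s → Acts s
      op-args : ∀ {f ts} → op f ts ~ op f ts → ∀ i → ts i ~ ts i
      app-cong : ∀ {a b s t} → a C.≈ b → Acts s → Acts t → (∀ i → s i ~ t i) → app a s ~ app b t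
      op-cong : ∀ {f ts us} → (∀ i → ts i ~ us i) → op f ts ~ op f us
      app-e : ∀ i {s} → Acts s → app (C.e i) s ~ s i
      app-q : ∀ n a bs {s} → Acts s →
              app (C.q n a bs) s ~ app a (overwrite s (λ j → app (bs j) s))
      app-op : ∀ f as {s} → Acts s → app (C.⟦ f ⟧ as) s ~ op f (λ i → app (as i) s)

    domˡ : ∀ {t u} → t ~ u → t ~ t
    domˡ p = ~-trans p (~-sym p)

    domʳ : ∀ {t u} → t ~ u → u ~ u
    domʳ p = ~-trans (~-sym p) p

    app-dom : ∀ {a s} → Acts s → app a s ~ app a s
    app-dom s = app-cong C.refl s s (acts-dom s)

  -- Through `conservative`, an equation derived in a late stage comes down to the base stage, where
  -- it is an equation in C.
  record _⊑_ (X Z : Stage) : Set ℓ where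
    private
      module X = Stage X
      module Z = Stage Z
    field
      ~-mono : ∀ {t u} → t X.~ u → t Z.~ u
      acts-mono : ∀ {s} → X.Acts s → Z.Acts s
      conservative : ∀ {t u} → t X.~ t → u X.~ u → t Z.~ u → t X.~ u
  open _⊑_

  ⊑-refl : ∀ {X} → X ⊑ X
  ⊑-refl = record { ~-mono = λ p → p ; acts-mono = λ p → p ; conservative = λ _ _ p → p }

  ⊑-trans : ∀ {X Y Z} → X ⊑ Y → Y ⊑ Z → X ⊑ Z
  ⊑-trans XY YZ = record
    { ~-mono = ~-mono YZ ∘ ~-mono XY
    ; acts-mono = acts-mono YZ ∘ acts-mono XY
    ; conservative = λ t u → conservative XY t u ∘ conservative YZ (~-mono XY t) (~-mono XY u) }

  module Union (X : ℕ → Stage) (step : ∀ n → X n ⊑ X (suc n)) where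
    private module X n = Stage (X n)

    inclusion : ∀ {m n} → m ≤ n → X m ⊑ X n
    inclusion = go ∘ ≤⇒≤′
      where
      go : ∀ {m n} → m ≤′ n → X m ⊑ X n
      go (≤′-reflexive ≡.refl) = ⊑-refl
      go (≤′-step p) = ⊑-trans (go p) (step _)

    _~_ : Term → Term → Set ℓ
    t ~ u = Σ ℕ λ n → X._~_ n t u

    Acts : (ℕ → Term) → Set ℓ
    Acts s = Σ ℕ λ n → X.Acts n s

    -- This gives `app-cong` in the union: the equations between the entries of two threads may
    -- appear at unboundedly late stages, yet all of them descend to one stage where both threads
    -- act.
    descend : ∀ {n t u} → X._~_ n t t → X._~_ n u u → t ~ u → X._~_ n t u
    descend {n} t u (m , p) =
      conservative (inclusion (m≤m⊔n n m)) t u (~-mono (inclusion (m≤n⊔m n m)) p)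

    union : Stage
    union = record
      { _~_ = _~_
      ; Acts = Acts
      ; ~-sym = λ (n , p) → n , X.~-sym n p
      ; ~-trans = λ (n , p) (m , r) → n ⊔ m ,
          X.~-trans _ (~-mono (inclusion (m≤m⊔n n m)) p) (~-mono (inclusion (m≤n⊔m n m)) r)
      ; acts-dom = λ (n , s) i → n , X.acts-dom n s i
      ; acts-modify = λ {s} {t} N → modify N
      ; acts-var = 0 , X.acts-var 0
      ; app-acts = λ (n , p) → n , X.app-acts n p
      ; op-args = λ (n , p) i → n , X.op-args n p i
      ; app-cong = λ a≈b (n , s) (m , t) s~t →
          let s′ = acts-mono (inclusion (m≤m⊔n n m)) s
              t′ = acts-mono (inclusion (m≤n⊔m n m)) t
          in n ⊔ m , X.app-cong _ a≈b s′ t′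
               (λ i → descend (X.acts-dom _ s′ i) (X.acts-dom _ t′ i) (s~t i))
      ; op-cong = λ ts~us → let (N , p) = common ts~us in N , X.op-cong N p
      ; app-e = λ i (n , s) → n , X.app-e n i s
      ; app-q = λ k a bs (n , s) → n , X.app-q n k a bs s
      ; app-op = λ f as (n , s) → n , X.app-op n f as s }
      where
      common : ∀ {n} {ts us : Fin n → Term} → (∀ i → ts i ~ us i) → Σ ℕ λ N → ∀ i → X._~_ N (ts i) (us i)
      common {zero} p = 0 , λ ()
      common {suc n} p with p zero | common (p ∘ suc)
      ... | K , p₀ | L , ps = K ⊔ L , λ
        { zero → ~-mono (inclusion (m≤m⊔n K L)) p₀
        ; (suc i) → ~-mono (inclusion (m≤n⊔m K L)) (ps i) }
      modify : ∀ {s t} N → Acts s → (∀ i → t i ~ t i) → (∀ i → N ≤ i → t i ≡ s i) → Acts t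
      -- Only the entries of t below N can be new, so their stages have a maximum; the others are
      -- entries of s, defined wherever s acts.
      modify {s} {t} N (n , acts) dom eq = n ⊔ M , X.acts-modify _ N acts′ dom′ eq
        where
        low : Σ ℕ λ M → ∀ (i : Fin N) → X._~_ M (t (toℕ i)) (t (toℕ i))
        low = common (dom ∘ toℕ)
        M = proj₁ low
        acts′ = acts-mono (inclusion (m≤m⊔n n M)) acts
        dom′ : ∀ i → X._~_ (n ⊔ M) (t i) (t i)
        dom′ i with i <? N
        ... | yes p = ≡.subst (λ j → X._~_ _ (t j) (t j)) (toℕ-fromℕ< p)
                        (~-mono (inclusion (m≤n⊔m n M)) (proj₂ low (fromℕ< p)))
        ... | no ¬p = ≡.subst (λ u → X._~_ _ u u) (≡.sym (eq i (≮⇒≥ ¬p))) (X.acts-dom _ acts′ i)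

    upper : ∀ n → X n ⊑ union
    upper n = record
      { ~-mono = λ p → n , p ; acts-mono = λ s → n , s ; conservative = descend }

  -- Extending a stage to meet prescribed requirements

  Extendable : (Stage → Set ℓ) → Set (lsuc ℓ)
  Extendable P = ∀ X → Σ Stage λ Z → X ⊑ Z × P Z

  Monotone : (Stage → Set ℓ) → Set (lsuc ℓ)
  Monotone P = ∀ {X Z} → X ⊑ Z → P X → P Z

  -- Requirement i is met at step i + 1 of a chain and persists to the union.
  extend-∀ : {P : ℕ → Stage → Set ℓ} → (∀ i → Monotone (P i)) → (∀ i → Extendable (P i)) →
             Extendable (λ Z → ∀ i → P i Z)
  extend-∀ {P} mono ext X =
    U.union , U.upper 0 , λ i → mono i (U.upper (suc i)) (ext i (chain i) .proj₂ .proj₂)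
    where
    chain : ℕ → Stage
    chain zero = X
    chain (suc n) = ext n (chain n) .proj₁
    module U = Union chain (λ n → ext n (chain n) .proj₂ .proj₁)

  extend-Fin : ∀ {n} {P : Fin n → Stage → Set ℓ} → (∀ i → Monotone (P i)) →
               (∀ i → Extendable (P i)) → Extendable (λ Z → ∀ i → P i Z)
  extend-Fin {zero} mono ext X = X , ⊑-refl , λ ()
  extend-Fin {suc n} mono ext X with ext zero X
  ... | Y , XY , p with extend-Fin (mono ∘ suc) (ext ∘ suc) Y
  ... | Z , YZ , ps = Z , ⊑-trans XY YZ , λ { zero → mono zero YZ p ; (suc i) → ps i }

  -- The one-step extension of a stage

  module Adjoin (X : Stage) where
    open Stage X

    infix 4 _~⁺_
    data _~⁺_ : Term → Term → Set ℓ
    -- All sequences of old terms act, and so do their finite modifications by new terms. Tails stay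
    -- old, so that they can be compared in the old stage.
    Acts⁺ : (ℕ → Term) → Set ℓ
    Acts⁺ s = (∀ i → s i ~⁺ s i) × Σ ℕ λ n → ∀ i → n ≤ i → s i ~ s i

    data _~⁺_ where
      η : ∀ {t u} → t ~ u → t ~⁺ u
      sym⁺ : ∀ {t u} → t ~⁺ u → u ~⁺ t
      trans⁺ : ∀ {t u v} → t ~⁺ u → u ~⁺ v → t ~⁺ v
      -- Tails are compared by `~`, so that tails of values can be matched uniformly in the index.
      -- The full `app-cong` is recovered through `reflect`.
      app⁺ : ∀ {a b s t} n → a C.≈ b → (∀ i → i < n → s i ~⁺ t i) → (∀ i → n ≤ i → s i ~ t i) →
             app a s ~⁺ app b t
      op⁺ : ∀ {f ts us} → (∀ i → ts i ~⁺ us i) → op f ts ~⁺ op f us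
      e⁺ : ∀ i {s} → Acts⁺ s → app (C.e i) s ~⁺ s i
      q⁺ : ∀ n a bs {s} → Acts⁺ s →
           app (C.q n a bs) s ~⁺ app a (overwrite s (λ j → app (bs j) s))
      ⟦⟧⁺ : ∀ f as {s} → Acts⁺ s → app (C.⟦ f ⟧ as) s ~⁺ op f (λ i → app (as i) s)

    -- A term over the new threads denotes a sequence of terms of the old stage, up to eventual
    -- equality: a thread with an old one as tail acts as that one, and at index k any other
    -- thread s acts as s₀ , … , s_{k-1} , var k , var (k + 1) , …  Which case applies is not
    -- decidable, but finitely many decisions may be assumed when the goal R is fixed.
    module Valuation (R : Set ℓ) where
      open Continuation R

      Near : (ℕ → Term) → Set ℓ
      Near s = Σ (ℕ → Term) λ u → Acts u × Σ ℕ λ n → ∀ i → n ≤ i → s i ~ u i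

      data Tail (s : ℕ → Term) (F : ℕ → ℕ → Term) : Set ℓ where
        near : ∀ {u} n → Acts u → (∀ i → n ≤ i → s i ~ u i) → (∀ i → n ≤ i → ∀ k → F k i ~ u i) →
               Tail s F
        far : ∀ n → (Near s → R) → (∀ i → n ≤ i → s i ~ s i) →
              (∀ i → n ≤ i → ∀ k → i < k → F k i ~ s i) →
              (∀ i → n ≤ i → ∀ k → k ≤ i → F k i ~ var i) → Tail s F

      infix 4 _⇝_
      -- A relation, since values exist under `Cont` only; `total` gives existence, and `unique`
      -- uniqueness up to eventual equality.
      data _⇝_ : Term → (ℕ → Term) → Set ℓ

      -- At index k, C acts on `F k` in place of s. The index from which `component` holds may grow
      -- with i, so `tail` controls almost all entries at once.
      record Approx (s : ℕ → Term) (F : ℕ → ℕ → Term) : Set ℓ where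
        inductive
        field
          acts : ∀ k → Acts (F k)
          component : ∀ i → Σ (ℕ → Term) λ f → s i ⇝ f × ◇ (λ k → F k i ~ f k)
          tail : Tail s F

      data _⇝_ where
        const⇝ : ∀ {t} → t ~ t → t ⇝ λ _ → t
        app⇝ : ∀ {a s F} → Approx s F → app a s ⇝ λ k → app a (F k)
        op⇝ : ∀ {f ts} {fs : Fin (ar τ f) → ℕ → Term} → (∀ i → ts i ⇝ fs i) → op f ts ⇝ λ k → op f (λ i → fs i k)

      open Approx

      Agree : Term → Term → Set ℓ
      Agree t u = ∀ {f g} → t ⇝ f → u ⇝ g → ◇ (λ k → f k ~ g k)

      value-dom : ∀ {t f} → t ⇝ f → ∀ k → f k ~ f k
      value-dom (const⇝ p) k = p
      value-dom (app⇝ A) k = app-dom (acts A k)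
      value-dom (op⇝ p) k = op-cong (λ i → value-dom (p i) k)

      -- The thread of an old app term acts already, hence approximates itself by `near`; both
      -- constructors can then be treated alike.
      app⇝⁻¹ : ∀ {a s f} → app a s ⇝ f → Σ (ℕ → ℕ → Term) λ F → Approx s F × (∀ k → f k ≡ app a (F k))
      app⇝⁻¹ {s = s} (const⇝ p) = (λ _ → s) , record
        { acts = λ _ → app-acts p
        ; component = λ i → _ , const⇝ (dom i) , always (λ _ → dom i)
        ; tail = near 0 (app-acts p) (λ i _ → dom i) (λ i _ _ → dom i) } , λ _ → ≡.refl
        where dom = acts-dom (app-acts p)
      app⇝⁻¹ (app⇝ A) = _ , A , λ _ → ≡.refl

      op⇝⁻¹ : ∀ {f ts g} → op f ts ⇝ g →
              Σ (Fin (ar τ f) → ℕ → Term) λ fs → (∀ i → ts i ⇝ fs i) × (∀ k → g k ≡ op f (λ i → fs i k))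
      op⇝⁻¹ (const⇝ p) = _ , (λ i → const⇝ (op-args p i)) , λ _ → ≡.refl
      op⇝⁻¹ (op⇝ ps) = _ , ps , λ _ → ≡.refl

      tail-dom : ∀ {s F} → Tail s F → Σ ℕ λ n → ∀ i → n ≤ i → s i ~ s i
      tail-dom (near n _ s~u _) = n , λ i le → domˡ (s~u i le)
      tail-dom (far n _ dom _ _) = n , dom

      -- In the mixed cases a thread that is near makes the other one near, and `far` turns this
      -- into R. Two far tails are cut at the same k and so agree.
      tail-agree : ∀ {s t F G} → Tail s F → Tail t G → (Σ ℕ λ n → ∀ i → n ≤ i → s i ~ t i) →
                   Cont (Σ ℕ λ n → ∀ i → n ≤ i → ∀ k → F k i ~ G k i)
      tail-agree (near n _ s~u F~u) (near m _ t~v G~v) (l , s~t) = return (n ⊔ (m ⊔ l) , λ i le k →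
        let n≤i = ≤-trans (m≤m⊔n n _) le
            m⊔l≤i = ≤-trans (m≤n⊔m n _) le
            m≤i = ≤-trans (m≤m⊔n m l) m⊔l≤i
            l≤i = ≤-trans (m≤n⊔m m l) m⊔l≤i
        in ~-trans (F~u i n≤i k) (~-trans (~-sym (s~u i n≤i)) (~-trans (s~t i l≤i)
             (~-trans (t~v i m≤i) (~-sym (G~v i m≤i k))))))
      tail-agree (near n u s~u _) (far _ ¬near _ _ _) (l , s~t) _ = ¬near (_ , u , n ⊔ l , λ i le →
        ~-trans (~-sym (s~t i (≤-trans (m≤n⊔m n l) le))) (s~u i (≤-trans (m≤m⊔n n l) le)))
      tail-agree (far _ ¬near _ _ _) (near m v t~v _) (l , s~t) _ = ¬near (_ , v , m ⊔ l , λ i le →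
        ~-trans (s~t i (≤-trans (m≤n⊔m m l) le)) (t~v i (≤-trans (m≤m⊔n m l) le)))
      tail-agree {F = F} {G} (far n _ _ F~s F~var) (far m _ _ G~t G~var) (l , s~t) =
        return (n ⊔ (m ⊔ l) , agree)
        where
        agree : ∀ i → n ⊔ (m ⊔ l) ≤ i → ∀ k → F k i ~ G k i
        agree i le k with ≤-<-connex k i
        ... | inj₁ k≤i = ~-trans (F~var i n≤i k k≤i) (~-sym (G~var i m≤i k k≤i))
          where
          n≤i = ≤-trans (m≤m⊔n n _) le
          m≤i = ≤-trans (m≤m⊔n m l) (≤-trans (m≤n⊔m n _) le)
        ... | inj₂ i<k = ~-trans (F~s i n≤i k i<k) (~-trans (s~t i l≤i) (~-sym (G~t i m≤i k i<k)))
          where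
          n≤i = ≤-trans (m≤m⊔n n _) le
          m≤i = ≤-trans (m≤m⊔n m l) (≤-trans (m≤n⊔m n _) le)
          l≤i = ≤-trans (m≤n⊔m m l) (≤-trans (m≤n⊔m n _) le)

      -- Beyond some n the tails agree at every k; the finitely many entries before n agree from a
      -- common index on.
      approx-agree : ∀ {s t F G} → Approx s F → Approx t G → (∀ i → Agree (s i) (t i)) →
                     (Σ ℕ λ n → ∀ i → n ≤ i → s i ~ t i) → ◇ (λ k → ∀ i → F k i ~ G k i)
      approx-agree {F = F} {G} A B agree s~t = do
        (n , high) ← tail-agree (tail A) (tail B) s~t
        always (combine n high) ⊛ ◇-all {n = n} (λ j → low (toℕ j))
        where
        low : ∀ i → ◇ (λ k → F k i ~ G k i)
        low i with component A i | component B i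
        ... | f , s⇝f , F~f | g , t⇝g , G~g =
          always (λ _ x y z → ~-trans x (~-trans y (~-sym z))) ⊛ F~f ⊛ agree i s⇝f t⇝g ⊛ G~g
        combine : ∀ n → (∀ i → n ≤ i → ∀ k → F k i ~ G k i) →
                  ∀ k → (∀ (j : Fin n) → F k (toℕ j) ~ G k (toℕ j)) → ∀ i → F k i ~ G k i
        combine n high k lo i with i <? n
        ... | yes p = ≡.subst (λ j → F k j ~ G k j) (toℕ-fromℕ< p) (lo (fromℕ< p))
        ... | no ¬p = high i (≮⇒≥ ¬p) k

      app-agree : ∀ {a b s t} → a C.≈ b → (∀ i → Agree (s i) (t i)) →
                  (Σ ℕ λ n → ∀ i → n ≤ i → s i ~ t i) → Agree (app a s) (app b t)
      app-agree a≈b agree s~t d e with app⇝⁻¹ d | app⇝⁻¹ e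
      ... | F , A , f≡ | G , B , g≡ =
        always (λ k F~G → ≡.subst₂ _~_ (≡.sym (f≡ k)) (≡.sym (g≡ k))
                            (app-cong a≈b (acts A k) (acts B k) F~G))
        ⊛ approx-agree A B agree s~t

      op-agree : ∀ {f ts us} → (∀ i → Agree (ts i) (us i)) → Agree (op f ts) (op f us)
      op-agree agree d e with op⇝⁻¹ d | op⇝⁻¹ e
      ... | fs , ts⇝fs , f≡ | gs , us⇝gs , g≡ =
        always (λ k fs~gs → ≡.subst₂ _~_ (≡.sym (f≡ k)) (≡.sym (g≡ k)) (op-cong fs~gs))
        ⊛ ◇-all (λ i → agree i (ts⇝fs i) (us⇝gs i))

      unique : ∀ t → Agree t t
      unique (var i) (const⇝ p) (const⇝ _) = always (λ _ → p)
      unique (op f ts) = op-agree (λ i → unique (ts i))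
      unique (app a s) d = app-agree C.refl (λ i → unique (s i)) (tail-dom (tail (app⇝⁻¹ d .proj₂ .proj₁))) d

      η-agree : ∀ {t u} → t ~ u → Agree t u
      η-agree {t} {u} p d e =
        always (λ _ x y → ~-trans x (~-trans p (~-sym y)))
        ⊛ unique t d (const⇝ (domˡ p)) ⊛ unique u e (const⇝ (domʳ p))

      -- Nearness depends on the tail only, so the case of `Tail` is kept and its bound moved past
      -- n.
      overwrite-approx : ∀ {n s F} (bs : Fin n → C.Carrier) → Approx s F →
        Approx (overwrite s (λ j → app (bs j) s)) (λ k → overwrite (F k) (λ j → app (bs j) (F k)))
      overwrite-approx {n} {s} {F} bs A = record
        { acts = λ k → acts-modify n (acts A k) (dom k) (λ i → overwrite-≥ (F k) _)
        ; component = comp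
        ; tail = shift (tail A) }
        where
        s′ = overwrite s (λ j → app (bs j) s)
        F′ : ℕ → ℕ → Term
        F′ k = overwrite (F k) (λ j → app (bs j) (F k))
        dom : ∀ k i → F′ k i ~ F′ k i
        dom k i with i <? n
        ... | yes _ = app-dom (acts A k)
        ... | no _ = acts-dom (acts A k) i
        comp : ∀ i → Σ (ℕ → Term) λ f → s′ i ⇝ f × ◇ (λ k → F′ k i ~ f k)
        comp i with i <? n
        ... | yes _ = _ , app⇝ A , always (λ k → app-dom (acts A k))
        ... | no _ = component A i
        s≡ : ∀ i → n ≤ i → s i ≡ s′ i
        s≡ i n≤i = ≡.sym (overwrite-≥ s _ n≤i)
        F≡ : ∀ k i → n ≤ i → F k i ≡ F′ k i
        F≡ k i n≤i = ≡.sym (overwrite-≥ (F k) _ n≤i)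
        shift : Tail s F → Tail s′ F′
        shift (near {u} m U s~u F~u) = near (n ⊔ m) U
          (λ i le → ≡.subst (_~ u i) (s≡ i (≤-trans (m≤m⊔n n m) le)) (s~u i (≤-trans (m≤n⊔m n m) le)))
          (λ i le k → ≡.subst (_~ u i) (F≡ k i (≤-trans (m≤m⊔n n m) le)) (F~u i (≤-trans (m≤n⊔m n m) le) k))
        shift (far m ¬near sdom F~s F~var) = far (n ⊔ m)
          (λ (u , U , l , s~u) → ¬near (u , U , n ⊔ l , λ i le →
             ≡.subst (_~ u i) (≡.sym (s≡ i (≤-trans (m≤m⊔n n l) le))) (s~u i (≤-trans (m≤n⊔m n l) le))))
          (λ i le → ≡.subst (λ t → t ~ t) (s≡ i (≤-trans (m≤m⊔n n m) le)) (sdom i (≤-trans (m≤n⊔m n m) le)))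
          (λ i le k i<k → ≡.subst₂ _~_ (F≡ k i (≤-trans (m≤m⊔n n m) le)) (s≡ i (≤-trans (m≤m⊔n n m) le))
                            (F~s i (≤-trans (m≤n⊔m n m) le) k i<k))
          (λ i le k k≤i → ≡.subst (_~ var i) (F≡ k i (≤-trans (m≤m⊔n n m) le))
                            (F~var i (≤-trans (m≤n⊔m n m) le) k k≤i))

      Valued : Term → Set ℓ
      Valued t = ∃ λ f → t ⇝ f

      -- The decision on `Near s` selects a thread of old terms with the right tail; values then
      -- replace its finitely many entries where s may be new.
      approximable : ∀ {s} → (∀ i → Cont (Valued (s i))) → (Σ ℕ λ n → ∀ i → n ≤ i → s i ~ s i) →
                     Cont (∃ λ F → Approx s F)
      approximable {s} valued (n , dom) = do
        decision ← decide (Near s)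
        build decision
        where
        build : Near s ⊎ (Near s → R) → Cont (∃ λ F → Approx s F)
        build (inj₁ (u , U , m , s~u)) = do
          vs ← cont-all {n = m} (λ j → valued (toℕ j))
          return (_ , approx vs)
          where
          approx : (vs : ∀ (j : Fin m) → Valued (s (toℕ j))) →
                   Approx s (λ k → overwrite u (λ j → vs j .proj₁ k))
          approx vs = record
            { acts = λ k → acts-modify m U (F-dom k) (λ i → overwrite-≥ u _)
            ; component = comp
            ; tail = near m U s~u (λ i m≤i k → ≡.subst (_~ u i) (≡.sym (overwrite-≥ u _ m≤i)) (acts-dom U i)) }
            where
            F : ℕ → ℕ → Term
            F k = overwrite u (λ j → vs j .proj₁ k)
            F-dom : ∀ k i → F k i ~ F k i
            F-dom k i with i <? m
            ... | yes _ = value-dom (vs _ .proj₂) k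
            ... | no _ = acts-dom U i
            comp : ∀ i → Σ (ℕ → Term) λ f → s i ⇝ f × ◇ (λ k → F k i ~ f k)
            comp i with i <? m
            ... | yes p = _ , ≡.subst (λ j → s j ⇝ vs (fromℕ< p) .proj₁) (toℕ-fromℕ< p) (vs _ .proj₂)
                        , always (value-dom (vs _ .proj₂))
            ... | no ¬p = _ , const⇝ (domˡ (s~u i (≮⇒≥ ¬p))) , always (λ _ → ~-sym (s~u i (≮⇒≥ ¬p)))
        build (inj₂ ¬near) = do
          vs ← cont-all {n = n} (λ j → valued (toℕ j))
          return (_ , approx vs)
          where
          θ : ℕ → ℕ → Term
          θ k = truncate var k s
          θ~s : ∀ i → n ≤ i → ∀ k → i < k → θ k i ~ s i
          θ~s i n≤i k i<k = ≡.subst (_~ s i) (≡.sym (truncate-< var s i<k)) (dom i n≤i)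
          θ~var : ∀ i → ∀ k → k ≤ i → θ k i ~ var i
          θ~var i k k≤i = ≡.subst (_~ var i) (≡.sym (truncate-≥ var s k≤i)) (acts-dom acts-var i)
          approx : (vs : ∀ (j : Fin n) → Valued (s (toℕ j))) →
                   Approx s (λ k → overwrite (θ k) (λ j → vs j .proj₁ k))
          approx vs = record
            -- From n + k on, `F k` coincides with `var`, so it acts as a finite modification of
            -- `var`.
            { acts = λ k → acts-modify (n + k) acts-var (F-dom k) (λ i le →
                ≡.trans (overwrite-≥ (θ k) _ (≤-trans (m≤m+n n k) le))
                        (truncate-≥ var s (≤-trans (m≤n+m k n) le)))
            ; component = comp
            ; tail = far n ¬near dom
                (λ i n≤i k i<k → ≡.subst (_~ s i) (≡.sym (overwrite-≥ (θ k) _ n≤i)) (θ~s i n≤i k i<k))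
                (λ i n≤i k k≤i → ≡.subst (_~ var i) (≡.sym (overwrite-≥ (θ k) _ n≤i)) (θ~var i k k≤i)) }
            where
            F : ℕ → ℕ → Term
            F k = overwrite (θ k) (λ j → vs j .proj₁ k)
            F-dom : ∀ k i → F k i ~ F k i
            F-dom k i with i <? n
            ... | yes _ = value-dom (vs _ .proj₂) k
            ... | no ¬p with ≤-<-connex k i
            ... | inj₁ k≤i = domˡ (θ~var i k k≤i)
            ... | inj₂ i<k = domˡ (θ~s i (≮⇒≥ ¬p) k i<k)
            comp : ∀ i → Σ (ℕ → Term) λ f → s i ⇝ f × ◇ (λ k → F k i ~ f k)
            comp i with i <? n
            ... | yes p = _ , ≡.subst (λ j → s j ⇝ vs (fromℕ< p) .proj₁) (toℕ-fromℕ< p) (vs _ .proj₂)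
                        , always (value-dom (vs _ .proj₂))
            -- Entry i is still `var i` for k ≤ i and becomes s i from k = i + 1 on.
            ... | no ¬p = _ , const⇝ (dom i (≮⇒≥ ¬p)) , from (suc i) (θ~s i (≮⇒≥ ¬p))

      app-valued : ∀ {a s} → Cont (∃ λ F → Approx s F) → Cont (Valued (app a s))
      app-valued approx = do
        (_ , A) ← approx
        return (_ , app⇝ A)

      op-valued : ∀ {f ts} → (∀ i → Cont (Valued (ts i))) → Cont (Valued (op f ts))
      op-valued valued = do
        vs ← cont-all valued
        return (_ , op⇝ (λ i → vs i .proj₂))

      total : ∀ {t u} → t ~⁺ u → Cont (Valued t) × Cont (Valued u)
      total (η p) = return (_ , const⇝ (domˡ p)) , return (_ , const⇝ (domʳ p))
      total (sym⁺ p) = total p .proj₂ , total p .proj₁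
      total (trans⁺ p r) = total p .proj₁ , total r .proj₂
      total (app⁺ {s = s} {t} n _ lo hi) =
        app-valued (approximable (λ i → both i .proj₁) (n , λ i le → domˡ (hi i le))) ,
        app-valued (approximable (λ i → both i .proj₂) (n , λ i le → domʳ (hi i le)))
        where
        both : ∀ i → Cont (Valued (s i)) × Cont (Valued (t i))
        both i with i <? n
        ... | yes i<n = total (lo i i<n)
        ... | no i≮n = return (_ , const⇝ (domˡ (hi i (≮⇒≥ i≮n))))
                     , return (_ , const⇝ (domʳ (hi i (≮⇒≥ i≮n))))
      total (op⁺ ps) = op-valued (λ i → total (ps i) .proj₁) , op-valued (λ i → total (ps i) .proj₂)
      total (e⁺ i (dom , tail)) =
        app-valued (approximable (λ i → total (dom i) .proj₁) tail) , total (dom i) .proj₁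
      total (q⁺ n a bs {s} (dom , tail)) =
        app-valued approx , app-valued (do
          (_ , A) ← approx
          return (_ , overwrite-approx bs A))
        where approx = approximable (λ i → total (dom i) .proj₁) tail
      total (⟦⟧⁺ f as (dom , tail)) =
        app-valued approx , op-valued (λ _ → app-valued approx)
        where approx = approximable (λ i → total (dom i) .proj₁) tail

      -- Each identity holds in the old stage for the action on `F k`, for every k, and so passes to
      -- values.
      sound : ∀ {t u} → t ~⁺ u → Agree t u
      sound (η p) = η-agree p
      sound (sym⁺ p) d e = always (λ _ → ~-sym) ⊛ sound p e d
      sound (trans⁺ p r) d e = do
        -- Transitivity needs a value of the middle term.
        (_ , m) ← total p .proj₂
        always (λ _ → ~-trans) ⊛ sound p d m ⊛ sound r m e
      sound (app⁺ {s = s} {t} n a≈b lo hi) = app-agree a≈b agree (n , hi)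
        where
        agree : ∀ i → Agree (s i) (t i)
        agree i with i <? n
        ... | yes i<n = sound (lo i i<n)
        ... | no i≮n = η-agree (hi i (≮⇒≥ i≮n))
      sound (op⁺ ps) = op-agree (λ i → sound (ps i))
      sound (e⁺ i {s} _) d e with app⇝⁻¹ d
      ... | F , A , f≡ with component A i
      ... | f , s⇝f , F~f =
        always (λ k x y → ≡.subst (_~ _) (≡.sym (f≡ k)) (~-trans (app-e i (acts A k)) (~-trans x y)))
        ⊛ F~f ⊛ unique (s i) s⇝f e
      sound (q⁺ n a bs {s} _) d e with app⇝⁻¹ d
      ... | F , A , f≡ =
        always (λ k x → ≡.subst (_~ _) (≡.sym (f≡ k)) (~-trans (app-q n a bs (acts A k)) x))
        ⊛ unique _ (app⇝ (overwrite-approx bs A)) e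
      sound (⟦⟧⁺ f as {s} _) d e with app⇝⁻¹ d
      ... | F , A , f≡ =
        always (λ k x → ≡.subst (_~ _) (≡.sym (f≡ k)) (~-trans (app-op f as (acts A k)) x))
        ⊛ unique _ (op⇝ (λ i → app⇝ A)) e

    -- Old terms have constant values, so eventual agreement is already t ~ u. With t ~ u itself as
    -- the goal R, the continuation is discharged.
    reflect : ∀ {t u} → t ~ t → u ~ u → t ~⁺ u → t ~ u
    reflect {t} {u} p r d = sound d (const⇝ p) (const⇝ r) (λ (N , eq) → eq N ≤-refl)
      where open Valuation (t ~ u)

    -- An invariant for inverting definedness: `sym⁺` and `trans⁺` preclude direct inversion of a
    -- derivation, so `sub⁺` carries it along by induction.
    Sub⁺ : Term → Set ℓ
    Sub⁺ (var _) = ⊤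
    Sub⁺ (app _ s) = Acts⁺ s
    Sub⁺ (op _ ts) = ∀ i → ts i ~⁺ ts i

    acts⇒Acts⁺ : ∀ {s} → (∀ i → s i ~ s i) → Acts⁺ s
    acts⇒Acts⁺ dom = (λ i → η (dom i)) , 0 , λ i _ → dom i

    ~-sub⁺ : ∀ {t} → t ~ t → Sub⁺ t
    ~-sub⁺ {var _} _ = tt
    ~-sub⁺ {app _ _} p = acts⇒Acts⁺ (acts-dom (app-acts p))
    ~-sub⁺ {op _ _} p i = η (op-args p i)

    Acts⁺-refl : ∀ {a s} → Acts⁺ s → app a s ~⁺ app a s
    Acts⁺-refl (dom , n , tail) = app⁺ n C.refl (λ i _ → dom i) tail

    Acts⁺-overwrite : ∀ {n s} (bs : Fin n → C.Carrier) → Acts⁺ s →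
                      Acts⁺ (overwrite s (λ j → app (bs j) s))
    Acts⁺-overwrite {n} {s} bs S@(dom , m , tail) = dom′ , n ⊔ m , λ i le →
      ≡.subst (λ t → t ~ t) (≡.sym (overwrite-≥ s _ (≤-trans (m≤m⊔n n m) le)))
        (tail i (≤-trans (m≤n⊔m n m) le))
      where
      dom′ : ∀ i → overwrite s (λ j → app (bs j) s) i ~⁺ overwrite s (λ j → app (bs j) s) i
      dom′ i with i <? n
      ... | yes _ = Acts⁺-refl S
      ... | no _ = dom i

    sub⁺ : ∀ {t u} → t ~⁺ u → Sub⁺ t × Sub⁺ u
    sub⁺ (η p) = ~-sub⁺ (domˡ p) , ~-sub⁺ (domʳ p)
    sub⁺ (sym⁺ p) = sub⁺ p .proj₂ , sub⁺ p .proj₁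
    sub⁺ (trans⁺ p r) = sub⁺ p .proj₁ , sub⁺ r .proj₂
    sub⁺ (app⁺ {s = s} {t} n _ lo hi) =
      ((λ i → both i .proj₁) , n , λ i le → domˡ (hi i le)) ,
      ((λ i → both i .proj₂) , n , λ i le → domʳ (hi i le))
      where
      both : ∀ i → s i ~⁺ s i × t i ~⁺ t i
      both i with i <? n
      ... | yes i<n = trans⁺ (lo i i<n) (sym⁺ (lo i i<n)) , trans⁺ (sym⁺ (lo i i<n)) (lo i i<n)
      ... | no i≮n = η (domˡ (hi i (≮⇒≥ i≮n))) , η (domʳ (hi i (≮⇒≥ i≮n)))
    sub⁺ (op⁺ ps) = (λ i → trans⁺ (ps i) (sym⁺ (ps i))) , (λ i → trans⁺ (sym⁺ (ps i)) (ps i))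
    sub⁺ (e⁺ i S) = S , sub⁺ (S .proj₁ i) .proj₁
    sub⁺ (q⁺ n a bs S) = S , Acts⁺-overwrite bs S
    sub⁺ (⟦⟧⁺ f as S) = S , λ _ → Acts⁺-refl S

    adjoin : Stage
    adjoin = record
      { _~_ = _~⁺_
      ; Acts = Acts⁺
      ; ~-sym = sym⁺
      ; ~-trans = trans⁺
      ; acts-dom = proj₁
      ; acts-modify = λ {s} {t} N (_ , n , tail) dom eq → dom , N ⊔ n , λ i le →
          ≡.subst (λ t → t ~ t) (≡.sym (eq i (≤-trans (m≤m⊔n N n) le))) (tail i (≤-trans (m≤n⊔m N n) le))
      ; acts-var = acts⇒Acts⁺ (acts-dom acts-var)
      ; app-acts = λ p → sub⁺ p .proj₁
      ; op-args = λ p → sub⁺ p .proj₁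
      -- Past both bounds the entries are old, and `reflect` provides the old equations that `app⁺`
      -- demands.
      ; app-cong = λ a≈b (_ , n , s-tail) (_ , m , t-tail) s~t →
          app⁺ (n ⊔ m) a≈b (λ i _ → s~t i) (λ i le →
            reflect (s-tail i (≤-trans (m≤m⊔n n m) le)) (t-tail i (≤-trans (m≤n⊔m n m) le)) (s~t i))
      ; op-cong = op⁺
      ; app-e = e⁺
      ; app-q = q⁺
      ; app-op = ⟦⟧⁺ }

    ⊑-adjoin : X ⊑ adjoin
    ⊑-adjoin = record
      { ~-mono = η ; acts-mono = λ s → acts⇒Acts⁺ (acts-dom s) ; conservative = reflect }

  -- The congruence on infinitary terms and its derivations

  infix 4 _≈∞_
  data _≈∞_ : Term → Term → Set ℓ where
    refl∞ : ∀ {t} → t ≈∞ t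
    sym∞ : ∀ {t u} → t ≈∞ u → u ≈∞ t
    trans∞ : ∀ {t u v} → t ≈∞ u → u ≈∞ v → t ≈∞ v
    app∞ : ∀ {a b s t} → a C.≈ b → (∀ i → s i ≈∞ t i) → app a s ≈∞ app b t
    op∞ : ∀ {f ts us} → (∀ i → ts i ≈∞ us i) → op f ts ≈∞ op f us
    e∞ : ∀ i {s} → app (C.e i) s ≈∞ s i
    q∞ : ∀ n a bs {s} → app (C.q n a bs) s ≈∞ app a (overwrite s (λ j → app (bs j) s))
    ⟦⟧∞ : ∀ f as {s} → app (C.⟦ f ⟧ as) s ≈∞ op f (λ i → app (as i) s)

  infix 4 _⊢_~_
  _⊢_~_ : Stage → Term → Term → Set ℓ
  X ⊢ t ~ u = Stage._~_ X t u

  -- A union of a chain proves all premises in one stage Z. There both threads consist of defined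
  -- terms, so one `adjoin` makes them act.
  extend-app : ∀ {a b s t} → a C.≈ b → (∀ i → Extendable (λ Z → Z ⊢ s i ~ t i)) →
               Extendable (λ Z → Z ⊢ app a s ~ app b t)
  extend-app a≈b ext X with extend-∀ (λ _ XZ → ~-mono XZ) ext X
  ... | Z , XZ , s~t =
    adjoin , ⊑-trans XZ ⊑-adjoin , Stage.app-cong adjoin a≈b
      (acts⇒Acts⁺ (Stage.domˡ Z ∘ s~t)) (acts⇒Acts⁺ (Stage.domʳ Z ∘ s~t)) (η ∘ s~t)
    where open Adjoin Z

  extend-op : ∀ {f ts us} → (∀ i → Extendable (λ Z → Z ⊢ ts i ~ us i)) →
              Extendable (λ Z → Z ⊢ op f ts ~ op f us)
  extend-op ext X with extend-Fin (λ _ XZ → ~-mono XZ) ext X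
  ... | Z , XZ , ts~us = Z , XZ , Stage.op-cong Z ts~us

  extend-dom : ∀ t → Extendable (λ Z → Z ⊢ t ~ t)
  extend-dom (var i) X = X , ⊑-refl , Stage.acts-dom X (Stage.acts-var X) i
  extend-dom (app a s) = extend-app C.refl (λ i → extend-dom (s i))
  extend-dom (op f ts) = extend-op (λ i → extend-dom (ts i))

  extend-acts : C.Carrier → ∀ s → Extendable (λ Z → Stage.Acts Z s)
  extend-acts a s X with extend-dom (app a s) X
  ... | Z , XZ , p = Z , XZ , Stage.app-acts Z p

  extend-≈∞ : ∀ {t u} → t ≈∞ u → Extendable (λ Z → Z ⊢ t ~ u)
  extend-≈∞ (refl∞ {t}) X = extend-dom t X
  extend-≈∞ (sym∞ p) X with extend-≈∞ p X
  ... | Z , XZ , t~u = Z , XZ , Stage.~-sym Z t~u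
  extend-≈∞ (trans∞ p r) X with extend-≈∞ p X
  ... | Y , XY , t~u with extend-≈∞ r Y
  ... | Z , YZ , u~v = Z , ⊑-trans XY YZ , Stage.~-trans Z (~-mono YZ t~u) u~v
  extend-≈∞ (app∞ a≈b ps) = extend-app a≈b (λ i → extend-≈∞ (ps i))
  extend-≈∞ (op∞ ps) = extend-op (λ i → extend-≈∞ (ps i))
  extend-≈∞ (e∞ i {s}) X with extend-acts (C.e i) s X
  ... | Z , XZ , S = Z , XZ , Stage.app-e Z i S
  extend-≈∞ (q∞ n a bs {s}) X with extend-acts a s X
  ... | Z , XZ , S = Z , XZ , Stage.app-q Z n a bs S
  extend-≈∞ (⟦⟧∞ f as {s}) X with extend-acts (C.⟦ f ⟧ as) s X
  ... | Z , XZ , S = Z , XZ , Stage.app-op Z f as S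

  ≈∞-reflect : ∀ X {t u} → X ⊢ t ~ t → X ⊢ u ~ u → t ≈∞ u → X ⊢ t ~ u
  ≈∞-reflect X t u p with extend-≈∞ p X
  ... | Z , XZ , t~u = conservative XZ t u t~u

  TermAlgebra : Algebra τ
  TermAlgebra = record
    { Carrier = Term
    ; _≈_ = _≈∞_
    ; isEquivalence = record { refl = refl∞ ; sym = sym∞ ; trans = trans∞ }
    ; ⟦_⟧ = op
    ; ⟦⟧-cong = λ _ → op∞ }

  toFull : Hom C (Full TermAlgebra)
  toFull = record
    { h = λ a → app a , app∞ C.refl
    ; h-cong = λ a≈b s → app∞ a≈b (λ _ → refl∞)
    ; h-op = λ f as s → ⟦⟧∞ f as
    ; h-q = λ n a bs s → trans∞ (q∞ n a bs) (app∞ C.refl (λ i →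
        reflexive (≡.sym (upd≡overwrite TermAlgebra {n} s (λ j → app (bs j) s) i))))
    ; h-e = λ i s → e∞ i }
    where open Algebra TermAlgebra using (reflexive)

-- The base stage: evaluation in the clone algebra

module BaseStage {ℓ} {τ : Signature ℓ} (C : CloneStr τ) (isCA : IsCA C) where
  open CloneStr C
  open Action C isCA
  open Infinitary C

  infix 4 _⇓_
  -- Evaluation is partial: `act` requires the values along a thread to be eventually `e`.
  _⇓_ : Term → Carrier → Set ℓ
  var i ⇓ c = c ≈ e i
  app a s ⇓ c = Σ (Dom alg e) λ (cs , κ) → (∀ i → s i ⇓ cs i) × c ≈ act a (cs , κ)
  op f ts ⇓ c = Σ (Fin (ar τ f) → Carrier) λ cs → (∀ i → ts i ⇓ cs i) × c ≈ ⟦ f ⟧ cs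

  ⇓-unique : ∀ t {c d} → t ⇓ c → t ⇓ d → c ≈ d
  ⇓-unique (var i) c≈e d≈e = trans c≈e (sym d≈e)
  ⇓-unique (app a s) (cs , s⇓cs , c≈) (ds , s⇓ds , d≈) =
    trans c≈ (trans (act-cong refl {cs} {ds} (λ i → ⇓-unique (s i) (s⇓cs i) (s⇓ds i))) (sym d≈))
  ⇓-unique (op f ts) (cs , ts⇓cs , c≈) (ds , ts⇓ds , d≈) =
    trans c≈ (trans (⟦⟧-cong f (λ i → ⇓-unique (ts i) (ts⇓cs i) (ts⇓ds i))) (sym d≈))

  _~₀_ : Term → Term → Set ℓ
  t ~₀ u = Σ Carrier λ c → Σ Carrier λ d → t ⇓ c × u ⇓ d × c ≈ d

  Acts₀ : (ℕ → Term) → Set ℓ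
  Acts₀ s = Σ (Dom alg e) λ cs → ∀ i → s i ⇓ proj₁ cs i

  base : Stage
  base = record
    { _~_ = _~₀_
    ; Acts = Acts₀
    ; ~-sym = λ (c , d , t , u , c≈d) → d , c , u , t , sym c≈d
    ; ~-trans = λ {_} {u} (c , d , t , u₁ , c≈d) (d′ , f , u₂ , v , d′≈f) →
        c , f , t , v , trans c≈d (trans (⇓-unique u u₁ u₂) d′≈f)
    ; acts-dom = λ (cs , s⇓cs) i → _ , _ , s⇓cs i , s⇓cs i , refl
    -- By `⇓-unique`, the values of t match those of s from N on, and these are `e` from M on.
    ; acts-modify = λ {s} {t} N ((cs , M , cs≈e) , s⇓cs) dom eq →
        ((λ i → dom i .proj₁) , N + M , λ i le →
          trans (⇓-unique (s i) (≡.subst (_⇓ dom i .proj₁) (eq i (≤-trans (m≤m+n N M) le))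
                                         (dom i .proj₂ .proj₂ .proj₁))
                                (s⇓cs i))
                (cs≈e i (≤-trans (m≤n+m M N) le)))
        , λ i → dom i .proj₂ .proj₂ .proj₁
    ; acts-var = (e , 0 , λ _ _ → refl) , λ _ → refl
    ; app-acts = λ (_ , _ , (cs , s⇓cs , _) , _) → cs , s⇓cs
    ; op-args = λ (_ , _ , (cs , ts⇓cs , _) , _) i → _ , _ , ts⇓cs i , ts⇓cs i , refl
    ; app-cong = λ {_} {_} {s} {t} a≈b (cs , s⇓cs) (ds , t⇓ds) s~t →
        _ , _ , (cs , s⇓cs , refl) , (ds , t⇓ds , refl) , act-cong a≈b {cs} {ds} (λ i →
          let (c , d , s⇓c , t⇓d , c≈d) = s~t i
          in trans (⇓-unique (s i) (s⇓cs i) s⇓c) (trans c≈d (⇓-unique (t i) t⇓d (t⇓ds i))))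
    ; op-cong = λ {f} ts~us →
        _ , _ , (_ , (λ i → ts~us i .proj₂ .proj₂ .proj₁) , refl)
              , (_ , (λ i → ts~us i .proj₂ .proj₂ .proj₂ .proj₁) , refl)
              , ⟦⟧-cong f (λ i → ts~us i .proj₂ .proj₂ .proj₂ .proj₂)
    ; app-e = λ i (cs , s⇓cs) → _ , _ , (cs , s⇓cs , refl) , s⇓cs i , act-e i cs
    ; app-q = λ n a bs {s} (cs , s⇓cs) →
        let ds = overwrite (proj₁ cs) (λ j → act (bs j) cs) , cofinite n bs cs
        in _ , _ , (cs , s⇓cs , refl) , (ds , evaluate n bs s cs s⇓cs , refl)
             , act-q n a bs cs ds (λ _ → refl)
    ; app-op = λ f as (cs , s⇓cs) →
        _ , _ , (cs , s⇓cs , refl) , (_ , (λ i → cs , s⇓cs , refl) , refl) , act-op f as cs }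
    where
    cofinite : ∀ n (bs : Fin n → Carrier) (cs : Dom alg e) →
               Cof alg e (overwrite (proj₁ cs) (λ j → act (bs j) cs))
    cofinite n bs (cs , N , cs≈e) = n + N , λ i le →
      trans (reflexive (overwrite-≥ cs _ (≤-trans (m≤m+n n N) le))) (cs≈e i (≤-trans (m≤n+m N n) le))
    evaluate : ∀ n (bs : Fin n → Carrier) s (cs : Dom alg e) → (∀ i → s i ⇓ proj₁ cs i) →
               ∀ i → overwrite s (λ j → app (bs j) s) i ⇓ overwrite (proj₁ cs) (λ j → act (bs j) cs) i
    evaluate n bs s cs s⇓cs i with i <? n
    ... | yes _ = cs , s⇓cs , refl
    ... | no _ = s⇓cs i

  -- At the thread `var` both sides are defined in the base stage, with values a and b by
  -- `act-thread`.
  toFull-injective : Injective toFull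
  toFull-injective {a} {b} eq
    with ≈∞-reflect base (Stage.app-dom base (Stage.acts-var base))
                         (Stage.app-dom base (Stage.acts-var base)) (eq var)
  ... | c , d , (cs , cs≈e , c≈) , (ds , ds≈e , d≈) , c≈d =
    trans (sym (act-thread a cs cs≈e)) (trans (sym c≈)
      (trans c≈d (trans d≈ (act-thread b ds ds≈e))))

-- Functional representation and the equality of the classes

CA⇒IFCA : (C : CloneStr τ) → IsCA C → IFCA C
CA⇒IFCA C ca = TermAlgebra , Image toFull , Image-closed toFull , Image-≅ toFull toFull-injective
  where
  open Infinitary C
  open BaseStage C ca

mainTheorem1 : {ℓ : Level} (τ : Signature ℓ) (C : CloneStr τ) →
    (IsCA C ⇔ IRCA C) × (IsCA C ⇔ IFCA C) ×
    (IsCA C ⇔ HSP IsFiCA C) × (IsCA C ⇔ HSP IBLK C)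
mainTheorem1 τ C =
  mk⇔ (CA⇒IRCA C) (IRCA⇒CA C) ,
  mk⇔ (CA⇒IFCA C) (IFCA⇒CA C) ,
  mk⇔ (λ ca → CA⇒HSP C ca IsFiCA (Blocks.Block-isFiCA _)) (HSP-isCA {K = IsFiCA} proj₁) ,
  mk⇔ (λ ca → CA⇒HSP C ca IBLK (Blocks.Block-isBLK _)) (HSP-isCA (λ {B} → IBLK⇒CA B))
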